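{- Let $p$ be a large prime number, let $g\ge 2$ be an integer of multiplicative order $t$ modulo $p$, let $a,K,L$ be integers, and let $M$ be an integer with $1\le M<t$. Then the following bound holds: $$J_a(M;K,L)<\bigl(1+Mp^{ -1/8}\bigr)M^{1/3+o(1)}.$$
   Context: $J_a(M;K,L)$ denotes the number of solutions in integers $(x,y)$ of the congruence $y\equiv a g^x\pmod p$ with $x\in[K+1,K+M]$ and $y\in[L+1,L+M]$ (for negative $x$, $g^x$ is read via the inverse of $g$ modulo $p$). The notation $B^{o(1)}$ denotes a quantity such that for any $\varepsilon>0$ there exists $c=c(\varepsilon)>0$ with $B^{o(1)}<cB^{\varepsilon}$; $M^{1/3+o(1)}$ means $M^{1/3}\cdot M^{o(1)}$.
   Formalization: The formal theorem adds the assumption that p does not divide a; otherwise the claim fails, e.g. for a = 0, L = -1, g a primitive root and M = ⌊p^{1/8}⌋, where y = 0 makes every x a solution and J ≥ M. -}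

module Defs where

open import Data.Fin using (Fin; toℕ)
import Data.Fin.Properties as Fin
open import Data.Integer as ℤ using (ℤ; +_; -[1+_])
open import Data.Integer.Divisibility.Signed using (_∣_; _∣?_)
import Data.Integer.Properties as ℤ
open import Data.List using (List; length; filter; map; upTo; cartesianProduct)
open import Data.Nat as ℕ using (ℕ; zero; suc)
import Data.Nat.Properties as ℕ
open import Data.Product using (∃-syntax; _×_; _,_)
open import Data.Rational as ℚ using (ℚ; 0ℚ; 1ℚ; ↥_; ↧ₙ_; Positive; *≤*; *<*)
import Data.Rational.Properties as ℚ
import Data.Rational.Unnormalised as ℚᵘ
import Data.Rational.Unnormalised.Properties as ℚᵘ
open import Relation.Binary.PropositionalEquality
  using (_≡_; refl; sym; trans; subst; subst₂)
open import Relation.Nullary using (Dec; yes; no; contradiction)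
open import Relation.Nullary.Decidable using (_×-dec_)
open import Relation.Unary using (Pred)
open import Level using (0ℓ)

open import Algebra.Bundles using (CommutativeRing)
open import Algebra.Properties.Semiring.Exp
  (CommutativeRing.semiring ℚ.+-*-commutativeRing)
  using (^-assocʳ) renaming (_^_ to _^ℚ_)

infix 4 _≈_[mod_]

_≈_[mod_] : ℤ → ℤ → ℕ → Set
x ≈ y [mod n ] = + n ∣ x ℤ.- y

record IsMultiplicativeOrder (t g n : ℕ) : Set where
  field
    positive : 0 ℕ.< t
    identity : (+ g) ℤ.^ t ≈ + 1 [mod n ]
    minimal  : ∀ {s} → 0 ℕ.< s → (+ g) ℤ.^ s ≈ + 1 [mod n ] → t ℕ.≤ s

-- y ≡ a gˣ (mod p).  For x < 0 the power gˣ is h⁻ˣ, where h is the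
-- inverse of g among the residues 0, …, p - 1 (unique when it exists).
ExpCongruence : (p g : ℕ) (a x y : ℤ) → Set
ExpCongruence p g a (+ n)    y = y ≈ a ℤ.* (+ g) ℤ.^ n [mod p ]
ExpCongruence p g a -[1+ n ] y = ∃[ h ]
  (+ g ℤ.* + toℕ {p} h ≈ + 1 [mod p ]) ×
  (y ≈ a ℤ.* (+ toℕ h) ℤ.^ suc n [mod p ])

expCongruence? : ∀ p g a x y → Dec (ExpCongruence p g a x y)
expCongruence? p g a (+ n)    y = + p ∣? _
expCongruence? p g a -[1+ n ] y = Fin.any? λ h → (+ p ∣? _) ×-dec (+ p ∣? _)

interval : ℤ → ℕ → List ℤ
interval K M = map (λ i → K ℤ.+ + suc i) (upTo M)

-- Pitfall: if p ∣ a and some y in the second interval is divisible by p,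
-- then every x is a solution, so J ≥ M; bounds on J need p ∤ a.
J : (p g : ℕ) (a : ℤ) (M : ℕ) (K L : ℤ) → ℕ
J p g a M K L = length
  (filter (λ (x , y) → expCongruence? p g a x y)
          (cartesianProduct (interval K M) (interval L M)))

-- A real number is the set of the rationals strictly below it;
-- `zero∈` says that it is positive.
record ℝ⁺ : Set₁ where
  field
    lower   : Pred ℚ 0ℓ
    zero∈   : lower 0ℚ
    down    : ∀ {q r} → q ℚ.< r → lower r → lower q
    open′   : ∀ {q} → lower q → ∃[ r ] q ℚ.< r × lower r
    bounded : ∃[ u ] (∀ {q} → lower q → q ℚ.≤ u)

open ℝ⁺

infix 4 _∈_ _<_

_∈_ : ℚ → ℝ⁺ → Set
q ∈ α = lower α q

_<_ : ℕ → ℝ⁺ → Set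
n < α = (+ n ℚ./ 1) ∈ α

private
  positiveMember : ∀ α → ∃[ q ] 0ℚ ℚ.< q × q ∈ α
  positiveMember α = open′ α (zero∈ α)

  0≤bound : ∀ α {u} → (∀ {q} → q ∈ α → q ℚ.≤ u) → 0ℚ ℚ.≤ u
  0≤bound α b = b (zero∈ α)

  *-mono-≤ : ∀ {a b c d} → 0ℚ ℚ.≤ a → 0ℚ ℚ.≤ d → a ℚ.≤ b → c ℚ.≤ d →
             a ℚ.* c ℚ.≤ b ℚ.* d
  *-mono-≤ {a} {b} {c} {d} 0≤a 0≤d a≤b c≤d = ℚ.≤-trans
    (ℚ.*-monoˡ-≤-nonNeg a {{ℚ.nonNegative 0≤a}} c≤d)
    (ℚ.*-monoʳ-≤-nonNeg d {{ℚ.nonNegative 0≤d}} a≤b)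

  *-pos : ∀ {a b} → 0ℚ ℚ.< a → 0ℚ ℚ.< b → 0ℚ ℚ.< a ℚ.* b
  *-pos {a} {b} 0<a 0<b = subst (ℚ._< a ℚ.* b) (ℚ.*-zeroʳ a)
    (ℚ.*-monoʳ-<-pos a {{ℚ.positive 0<a}} 0<b)

  inverse : ∀ {r} → 0ℚ ℚ.< r → ∃[ s ] 0ℚ ℚ.< s × r ℚ.* s ≡ 1ℚ
  inverse {r} 0<r = s , ℚ.positive⁻¹ s {{ℚ.1/pos⇒pos r}} , ℚ.*-inverseʳ r
    where
    instance
      r-pos = ℚ.positive 0<r
      r-nz  = ℚ.pos⇒nonZero r
    s = ℚ.1/ r

fromℚ : (q : ℚ) .{{_ : Positive q}} → ℝ⁺
fromℚ q = record
  { lower   = ℚ._< q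
  ; zero∈   = ℚ.positive⁻¹ q
  ; down    = ℚ.<-trans
  ; open′   = ℚ.<-dense
  ; bounded = q , ℚ.<⇒≤
  }

fromℕ : (n : ℕ) .{{_ : ℕ.NonZero n}} → ℝ⁺
fromℕ n@(suc _) = fromℚ (+ n ℚ./ 1) {{ℚ.normalize-pos n 1}}

infixl 6 _+_
infixl 7 _*_
infixr 8 _^_
infix  9 _⁻¹

_+_ : ℝ⁺ → ℝ⁺ → ℝ⁺
α + β = record
  { lower   = λ q → ∃[ r ] ∃[ s ] r ∈ α × s ∈ β × q ℚ.< r ℚ.+ s
  ; zero∈   = let r , 0<r , r∈ = positiveMember α
                  s , 0<s , s∈ = positiveMember β
              in  r , s , r∈ , s∈ , ℚ.+-mono-< 0<r 0<s
  ; down    = λ { q<q′ (r , s , r∈ , s∈ , q′<) →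
                  r , s , r∈ , s∈ , ℚ.<-trans q<q′ q′< }
  ; open′   = λ { (r , s , r∈ , s∈ , q<) →
                  let m , q<m , m< = ℚ.<-dense q<
                  in  m , q<m , r , s , r∈ , s∈ , m< }
  ; bounded = let u , α≤u = bounded α
                  v , β≤v = bounded β
              in  u ℚ.+ v , λ { (r , s , r∈ , s∈ , q<) →
                    ℚ.≤-trans (ℚ.<⇒≤ q<) (ℚ.+-mono-≤ (α≤u r∈) (β≤v s∈)) }
  }

_*_ : ℝ⁺ → ℝ⁺ → ℝ⁺
α * β = record
  { lower   = λ q → ∃[ r ] ∃[ s ]
      0ℚ ℚ.< r × 0ℚ ℚ.< s × r ∈ α × s ∈ β × q ℚ.< r ℚ.* s
  ; zero∈   = let r , 0<r , r∈ = positiveMember α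
                  s , 0<s , s∈ = positiveMember β
              in  r , s , 0<r , 0<s , r∈ , s∈ , *-pos 0<r 0<s
  ; down    = λ { q<q′ (r , s , 0<r , 0<s , r∈ , s∈ , q′<) →
                  r , s , 0<r , 0<s , r∈ , s∈ , ℚ.<-trans q<q′ q′< }
  ; open′   = λ { (r , s , 0<r , 0<s , r∈ , s∈ , q<) →
                  let m , q<m , m< = ℚ.<-dense q<
                  in  m , q<m , r , s , 0<r , 0<s , r∈ , s∈ , m< }
  ; bounded = let u , α≤u = bounded α
                  v , β≤v = bounded β
              in  u ℚ.* v , λ { (r , s , 0<r , 0<s , r∈ , s∈ , q<) →
                    ℚ.≤-trans (ℚ.<⇒≤ q<)
                      (*-mono-≤ (ℚ.<⇒≤ 0<r) (0≤bound β β≤v) (α≤u r∈) (β≤v s∈)) }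
  }

-- q < α⁻¹ iff some q′ > q satisfies q′ ≤ r⁻¹ for every positive r < α.
_⁻¹ : ℝ⁺ → ℝ⁺
α ⁻¹ = record
  { lower   = λ q → ∃[ q′ ] q ℚ.< q′ × Below q′
  ; zero∈   = zero∈⁻¹
  ; down    = λ { q<r (q′ , r<q′ , b) → q′ , ℚ.<-trans q<r r<q′ , b }
  ; open′   = λ { (q′ , q<q′ , b) →
                  let m , q<m , m<q′ = ℚ.<-dense q<q′ in m , q<m , q′ , m<q′ , b }
  ; bounded = bounded⁻¹
  }
  where
  Below : Pred ℚ 0ℓ
  Below q = ∀ {r} → 0ℚ ℚ.< r → r ∈ α → r ℚ.* q ℚ.≤ 1ℚ

  zero∈⁻¹ : ∃[ q′ ] 0ℚ ℚ.< q′ × Below q′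
  zero∈⁻¹ with bounded α | positiveMember α
  ... | u , α≤u | w , 0<w , w∈ with inverse (ℚ.<-≤-trans 0<w (α≤u w∈))
  ... | s , 0<s , us≡1 = s , 0<s , λ {r} _ r∈ →
    subst (r ℚ.* s ℚ.≤_) us≡1
      (ℚ.*-monoʳ-≤-nonNeg s {{ℚ.nonNegative (ℚ.<⇒≤ 0<s)}} (α≤u r∈))

  bounded⁻¹ : ∃[ u ] (∀ {q} → (∃[ q′ ] q ℚ.< q′ × Below q′) → q ℚ.≤ u)
  bounded⁻¹ with positiveMember α
  ... | w , 0<w , w∈ with inverse 0<w
  ... | s , 0<s , ws≡1 = s , λ { {q} (q′ , q<q′ , b) → ℚ.≤-trans (ℚ.<⇒≤ q<q′)
    (ℚ.*-cancelˡ-≤-pos w {{ℚ.positive 0<w}}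
      (subst (w ℚ.* q′ ℚ.≤_) (sym ws≡1) (b 0<w w∈))) }

private
  1≤^ : ∀ {x} → 1ℚ ℚ.≤ x → ∀ n → 1ℚ ℚ.≤ x ^ℚ n
  1≤^ 1≤x zero    = ℚ.≤-refl
  1≤^ 1≤x (suc n) = *-mono-≤ {1ℚ} {_} {1ℚ} (*≤* (ℤ.+≤+ ℕ.z≤n))
    (ℚ.≤-trans (*≤* (ℤ.+≤+ ℕ.z≤n)) (1≤^ 1≤x n)) 1≤x (1≤^ 1≤x n)

  1^ : ∀ n → 1ℚ ^ℚ n ≡ 1ℚ
  1^ zero    = refl
  1^ (suc n) = trans (ℚ.*-identityˡ _) (1^ n)

  ^-monoʳ-≤ : ∀ {x} → 1ℚ ℚ.≤ x → ∀ {m n} → m ℕ.≤ n → x ^ℚ m ℚ.≤ x ^ℚ n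
  ^-monoʳ-≤ 1≤x {n = n} ℕ.z≤n = 1≤^ 1≤x n
  ^-monoʳ-≤ {x} 1≤x (ℕ.s≤s m≤n) = ℚ.*-monoˡ-≤-nonNeg x
    {{ℚ.nonNegative (ℚ.≤-trans (*≤* (ℤ.+≤+ ℕ.z≤n)) 1≤x)}} (^-monoʳ-≤ 1≤x m≤n)

  ^-pos : ∀ {x} → 0ℚ ℚ.< x → ∀ n → 0ℚ ℚ.< x ^ℚ n
  ^-pos 0<x zero    = *<* (ℤ.+<+ (ℕ.s≤s ℕ.z≤n))
  ^-pos 0<x (suc n) = *-pos 0<x (^-pos 0<x n)

  ^-monoˡ-≤ : ∀ {x y} → 0ℚ ℚ.< x → x ℚ.≤ y → ∀ n → x ^ℚ n ℚ.≤ y ^ℚ n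
  ^-monoˡ-≤ 0<x x≤y zero    = ℚ.≤-refl
  ^-monoˡ-≤ 0<x x≤y (suc n) = *-mono-≤ (ℚ.<⇒≤ 0<x)
    (ℚ.<⇒≤ (^-pos (ℚ.<-≤-trans 0<x x≤y) n)) x≤y (^-monoˡ-≤ 0<x x≤y n)

  ^-monoˡ-< : ∀ {x y} → 0ℚ ℚ.< x → x ℚ.< y → ∀ n → x ^ℚ suc n ℚ.< y ^ℚ suc n
  ^-monoˡ-< {x} {y} 0<x x<y n = ℚ.<-≤-trans
    (ℚ.*-monoˡ-<-pos (x ^ℚ n) {{ℚ.positive (^-pos 0<x n)}} x<y)
    (ℚ.*-monoˡ-≤-nonNeg y {{ℚ.nonNegative (ℚ.<⇒≤ (ℚ.<-trans 0<x x<y))}}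
      (^-monoˡ-≤ 0<x (ℚ.<⇒≤ x<y) n))

  ^-cancel-≤ : ∀ {x y} → 0ℚ ℚ.< y → ∀ n → x ^ℚ suc n ℚ.≤ y ^ℚ suc n → x ℚ.≤ y
  ^-cancel-≤ {x} {y} 0<y n xⁿ≤yⁿ with x ℚ.≤? y
  ... | yes x≤y = x≤y
  ... | no  x≰y = contradiction
    (ℚ.<-≤-trans (^-monoˡ-< 0<y (ℚ.≰⇒> x≰y) n) xⁿ≤yⁿ) (ℚ.<-irrefl refl)

  numerator-bound : ∀ {r u} → 0ℚ ℚ.< r → r ℚ.≤ u →
                    ℤ.∣ ↥ r ∣ ℕ.≤ ℤ.∣ ↥ u ∣ ℕ.* ↧ₙ r
  numerator-bound {ℚ.mkℚ (+ a) b-1 _} {ℚ.mkℚ (+ c) d-1 _} _ (*≤* ad≤cb) =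
    ℕ.≤-trans (ℕ.m≤m*n a (suc d-1))
      (ℤ.drop‿+≤+ (subst₂ ℤ._≤_ (sym (ℤ.pos-* a (suc d-1)))
                                (sym (ℤ.pos-* c (suc b-1))) ad≤cb))
  numerator-bound {ℚ.mkℚ -[1+ _ ] _ _} (*<* ()) _
  numerator-bound {ℚ.mkℚ (+ a) b-1 _} {ℚ.mkℚ -[1+ _ ] d-1 _} _ (*≤* ad≤cb)
    with subst (ℤ._≤ _) (sym (ℤ.pos-* a (suc d-1))) ad≤cb
  ... | ()

  1≤fromℕ : ∀ n .{{_ : ℕ.NonZero n}} → 1ℚ ℚ.≤ + n ℚ./ 1
  1≤fromℕ n@(suc n-1) = ℚ.toℚᵘ-cancel-≤
    (ℚᵘ.≤-trans (ℚᵘ.*≤* (ℤ.+≤+ (ℕ.*-monoˡ-≤ 1 (ℕ.s≤s {0} {n-1} ℕ.z≤n))))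
      (ℚᵘ.≤-reflexive (ℚᵘ.≃-sym (ℚ.toℚᵘ-fromℚᵘ (ℚᵘ.mkℚᵘ (+ n) 0)))))

-- n ^ ε is the supremum of the rational powers n ^ (a / b) over the
-- positive a / b < ε, and q′ ≤ n ^ (a / b) means q′ ^ b ≤ n ^ a.  As a
-- supremum over smaller exponents this is correct because n ≥ 1.
_^_ : (n : ℕ) .{{_ : ℕ.NonZero n}} → ℝ⁺ → ℝ⁺
n ^ ε = record
  { lower   = λ q → ∃[ q′ ] q ℚ.< q′ × BelowPower q′
  ; zero∈   = let r , 0<r , r∈ = positiveMember ε
              in  1ℚ , *<* (ℤ.+<+ (ℕ.s≤s ℕ.z≤n)) , r , 0<r , r∈ ,
                  *<* (ℤ.+<+ (ℕ.s≤s ℕ.z≤n)) ,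
                  subst (ℚ._≤ x ^ℚ ℤ.∣ ↥ r ∣) (sym (1^ (↧ₙ r)))
                    (1≤^ (1≤fromℕ n) ℤ.∣ ↥ r ∣)
  ; down    = λ { q<r (q′ , r<q′ , b) → q′ , ℚ.<-trans q<r r<q′ , b }
  ; open′   = λ { (q′ , q<q′ , b) →
                  let m , q<m , m<q′ = ℚ.<-dense q<q′ in m , q<m , q′ , m<q′ , b }
  ; bounded = let u , ε≤u = bounded ε
                  k       = ℤ.∣ ↥ u ∣
              in  x ^ℚ k , λ { (q′ , q<q′ , r , 0<r , r∈ , 0<q′ , q′ᵇ≤) →
                    ℚ.≤-trans (ℚ.<⇒≤ q<q′)
                      (^-cancel-≤ (^-pos 0<x k) (ℚ.denominator-1 r)
                        (ℚ.≤-trans q′ᵇ≤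
                          (subst (x ^ℚ ℤ.∣ ↥ r ∣ ℚ.≤_)
                            (sym (^-assocʳ x k (↧ₙ r)))
                            (^-monoʳ-≤ (1≤fromℕ n) (numerator-bound 0<r (ε≤u r∈)))))) }
  }
  where
  x : ℚ
  x = + n ℚ./ 1

  0<x : 0ℚ ℚ.< x
  0<x = ℚ.<-≤-trans (*<* (ℤ.+<+ (ℕ.s≤s ℕ.z≤n))) (1≤fromℕ n)

  BelowPower : Pred ℚ 0ℓ
  BelowPower q = ∃[ r ] 0ℚ ℚ.< r × r ∈ ε ×
    0ℚ ℚ.< q × q ^ℚ ↧ₙ r ℚ.≤ x ^ℚ ℤ.∣ ↥ r ∣

module Submission where

-- If y = a gˣ has many solutions in the box, then some subinterval of the y-range of length
-- H ≈ p^(1/8) contains ℓ of them, and the ℓ³ products y₁ y₂ y₃ ≡ a³ g^(x₁+x₂+x₃) take at most 3M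
-- values; so it suffices that ∏ (Λ + xᵢ) ≡ μ ≢ 0 (mod p) has H^o(1) solutions with |xᵢ| ≤ H.
--
-- Fix one solution y.  Every other solution x gives a polynomial ∏ (X + xᵢ) - ∏ (X + yᵢ) of degree
-- at most two with root Λ modulo p.  Two such polynomials have a resultant of size O(H⁸) < p, which
-- therefore vanishes: either all of them are divisible by one linear polynomial with small
-- coefficients, or all are proportional to one quadratic polynomial.  In both cases this gives a
-- polynomial f for which ∏ f(xᵢ) = ∏ f(yᵢ) =: N is a nonzero integer of size O(H⁹), so each f(xᵢ)
-- is among the N^o(1) divisors of N, and f takes every value at most twice.

open import Algebra.Bundles using (CommutativeRing)
open import Data.Fin using (toℕ)
open import Data.Integer as ℤ using (ℤ; +_)
import Data.Integer.Divisibility.Signed as ℤ∣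
import Data.Integer.Properties as ℤ
open import Data.Integer.Tactic.RingSolver using (solve-∀)
open import Data.List
  using (List; []; _∷_; length; filter; map; _++_; cartesianProductWith; cartesianProduct;
         upTo; applyUpTo; deduplicate)
open import Data.List.Membership.Propositional using (find) renaming (_∈_ to _∈ˡ_)
import Data.List.Membership.Propositional.Properties as ∈
import Data.List.Properties as List
open import Data.List.Relation.Unary.All as All using (All; []; _∷_)
import Data.List.Relation.Unary.All.Properties as All
open import Data.List.Relation.Unary.AllPairs using ([]; _∷_)
open import Data.List.Relation.Unary.Any using (here; there)
import Data.List.Relation.Unary.Unique.DecPropositional.Properties as UniqueDec
open import Data.List.Relation.Unary.Unique.Propositional using (Unique)
import Data.List.Relation.Unary.Unique.Propositional.Properties as Unique
open import Data.Maybe using (nothing)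
open import Data.Nat as ℕ using (ℕ; zero; suc; _≤_; z≤n; s≤s; NonZero; NonTrivial; >-nonZero)
import Data.Nat.Coprimality as Coprime
import Data.Nat.DivMod as DivMod
import Data.Nat.Divisibility as ℕ∣
import Data.Nat.GCD as ℕ
open import Data.Nat.Induction using (<-rec)
open import Data.Nat.Primality as Prime using (Prime; prime; _Rough_; prime⇒nonZero)
import Data.Nat.Properties as ℕ
import Data.Nat.Tactic.RingSolver as ℕSolver
open import Data.Product using (∃-syntax; _×_; _,_; proj₁; proj₂)
import Data.Product.Properties as Product
open import Data.Rational as ℚ using (ℚ; mkℚ; 0ℚ; 1ℚ; ½; ↥_; ↧ₙ_; *≤*; *<*)
import Data.Rational.Properties as ℚ
open import Data.Sum using (_⊎_; inj₁; inj₂; [_,_]′)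
open import Level using (0ℓ)
open import Relation.Binary.Bundles using (Setoid)
open import Relation.Binary.Definitions using (DecidableEquality; tri<; tri≈; tri>)
open import Relation.Binary.PropositionalEquality
  using (_≡_; _≢_; refl; sym; trans; cong; cong₂; subst; subst₂; module ≡-Reasoning)
import Relation.Binary.Reasoning.Setoid as SetoidReasoning
open import Relation.Nullary using (¬_; yes; no; contradiction)
open import Relation.Nullary.Decidable using (¬?; decidable-stable)
open import Relation.Unary using (Pred; Decidable)
import Tactic.RingSolver as RingSolver
open import Tactic.RingSolver.Core.AlmostCommutativeRing
  using (AlmostCommutativeRing; fromCommutativeRing)
import Algebra.Properties.Semiring.Exp (CommutativeRing.semiring ℚ.+-*-commutativeRing) as ℚ^

import Defs

-- The exponent 1/8 comes from a weight count: the coefficients of a difference polynomial in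
-- degrees 2, 1, 0 have size H, H², H³, so the resultant of two of them has size H⁸, and a multiple
-- of p of that size must be 0 once H⁸ is below p by a constant factor. N is nonzero because p does
-- not divide a: every `Λ + yᵢ` is then a unit modulo p, and a zero of f at some `yᵢ` would
-- contradict this or produce one more small linear polynomial with root Λ. The block length is
-- moreover capped by M. Then N is O(M⁹), and the divisor bound costs M^o(1) instead of p^o(1).
-- There is no real arithmetic before the end: an estimate with exponent 1/k is an inequality
-- between k-th powers in ℕ, with 1/k inside ε. In the lower cuts every membership is strict, and
-- each strict step is paid for with a factor ½ that the constant absorbs.

-- Fibres, pigeonhole and lists without repetition.

module Counting where
  open import Data.Nat using (_+_; _*_)

  length-filter-¬ : {A : Set} {P : Pred A 0ℓ} (P? : Decidable P) (xs : List A) →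
    length xs ≡ length (filter P? xs) + length (filter (λ x → ¬? (P? x)) xs)
  length-filter-¬ P? [] = refl
  length-filter-¬ P? (x ∷ xs) with P? x
  ... | yes _ = cong suc (length-filter-¬ P? xs)
  ... | no _  = trans (cong suc (length-filter-¬ P? xs)) (sym (ℕ.+-suc _ _))

  length-cartesianProductWith : {A B C : Set} (f : A → B → C) (xs : List A) (ys : List B) →
    length (cartesianProductWith f xs ys) ≡ length xs * length ys
  length-cartesianProductWith f [] ys = refl
  length-cartesianProductWith f (x ∷ xs) ys =
    trans (List.length-++ (map (f x) ys))
      (cong₂ _+_ (List.length-map (f x) ys) (length-cartesianProductWith f xs ys))

  module _ {A B : Set} (_≟_ : DecidableEquality B) (f : A → B) where

    fibre : B → List A → List A
    fibre b = filter (λ x → f x ≟ b)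

    fibres≤⇒length≤ : ∀ {T} (keys : List B) (xs : List A) →
      All (λ x → f x ∈ˡ keys) xs →
      All (λ b → length (fibre b xs) ≤ T) keys →
      length xs ≤ length keys * T
    fibres≤⇒length≤ [] [] _ _ = z≤n
    fibres≤⇒length≤ [] (x ∷ xs) (() ∷ _) _
    fibres≤⇒length≤ {T} (b ∷ keys) xs f∈ (p ∷ ps) = begin
      length xs
        ≡⟨ length-filter-¬ (λ x → f x ≟ b) xs ⟩
      length (fibre b xs) + length rest
        ≤⟨ ℕ.+-mono-≤ p (fibres≤⇒length≤ keys rest rest∈
             (All.map (λ {c} q → ℕ.≤-trans (fibre-rest c) q) ps)) ⟩
      T + length keys * T ∎
      where
      open ℕ.≤-Reasoning
      rest : List A
      rest = filter (λ x → ¬? (f x ≟ b)) xs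
      rest∈ : All (λ x → f x ∈ˡ keys) rest
      rest∈ = All.map (λ { (here e , ne) → contradiction e ne ; (there i , _) → i })
        (All.zip (All.filter⁺ (λ x → ¬? (f x ≟ b)) f∈ , All.all-filter (λ x → ¬? (f x ≟ b)) xs))
      fibre-rest : ∀ c → length (fibre c rest) ≤ length (fibre c xs)
      fibre-rest c = go xs
        where
        go : ∀ ys → length (fibre c (filter (λ x → ¬? (f x ≟ b)) ys)) ≤ length (fibre c ys)
        go [] = z≤n
        go (y ∷ ys) with f y ≟ b
        go (y ∷ ys) | yes _ with f y ≟ c
        ... | yes _ = ℕ.m≤n⇒m≤1+n (go ys)
        ... | no _  = go ys
        go (y ∷ ys) | no _ with f y ≟ c
        ... | yes _ = s≤s (go ys)
        ... | no _  = go ys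

    pigeonhole : ∀ (b : B) (keys : List B) (xs : List A) →
      All (λ x → f x ∈ˡ (b ∷ keys)) xs →
      ∃[ c ] c ∈ˡ (b ∷ keys) × length xs ≤ length (b ∷ keys) * length (fibre c xs)
    pigeonhole b keys xs f∈ with largest b keys
      where
      largest : ∀ b keys → ∃[ c ] c ∈ˡ (b ∷ keys) ×
        All (λ d → length (fibre d xs) ≤ length (fibre c xs)) (b ∷ keys)
      largest b [] = b , here refl , ℕ.≤-refl ∷ []
      largest b (d ∷ keys) with largest d keys
      ... | c , c∈ , all≤ with ℕ.≤-total (length (fibre b xs)) (length (fibre c xs))
      ... | inj₁ b≤c = c , there c∈ , b≤c ∷ all≤
      ... | inj₂ c≤b = b , here refl , ℕ.≤-refl ∷ All.map (λ q → ℕ.≤-trans q c≤b) all≤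
    ... | c , c∈ , all≤ = c , c∈ , fibres≤⇒length≤ (b ∷ keys) xs f∈ all≤

  AtMost2-1 : {A B : Set} → (A → B) → Set
  AtMost2-1 f = ∀ {x y z} → f x ≡ f y → f x ≡ f z → x ≡ y ⊎ x ≡ z ⊎ y ≡ z

  module _ {A B : Set} (_≟_ : DecidableEquality B) (f : A → B) where

    fibre≤2 : AtMost2-1 f → ∀ {xs} → Unique xs → ∀ b → length (fibre _≟_ f b xs) ≤ 2
    fibre≤2 f-2-1 {xs} uniq b =
      go (Unique.filter⁺ (λ x → f x ≟ b) uniq) (All.all-filter (λ x → f x ≟ b) xs)
      where
      go : ∀ {ys} → Unique ys → All (λ x → f x ≡ b) ys → length ys ≤ 2
      go {[]} _ _ = z≤n
      go {_ ∷ []} _ _ = s≤s z≤n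
      go {_ ∷ _ ∷ []} _ _ = ℕ.≤-refl
      go {x ∷ y ∷ z ∷ _} ((x≢y ∷ x≢z ∷ _) ∷ (y≢z ∷ _) ∷ _) (ex ∷ ey ∷ ez ∷ _)
        with f-2-1 (trans ex (sym ey)) (trans ex (sym ez))
      ... | inj₁ e        = contradiction e x≢y
      ... | inj₂ (inj₁ e) = contradiction e x≢z
      ... | inj₂ (inj₂ e) = contradiction e y≢z

    2-1⇒length≤ : AtMost2-1 f → ∀ {xs} keys → Unique xs → All (λ x → f x ∈ˡ keys) xs →
      length xs ≤ length keys * 2
    2-1⇒length≤ f-2-1 {xs} keys uniq f∈ =
      fibres≤⇒length≤ _≟_ f keys xs f∈ (All.universal (fibre≤2 f-2-1 uniq) keys)

  unique⊆⇒length≤ : {A : Set} (_≟_ : DecidableEquality A) → ∀ {xs : List A} ys → Unique xs →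
    All (_∈ˡ ys) xs → length xs ≤ length ys
  unique⊆⇒length≤ _≟_ {xs} ys uniq xs⊆ys = subst (length xs ≤_) (ℕ.*-identityʳ (length ys))
    (fibres≤⇒length≤ _≟_ (λ x → x) ys xs xs⊆ys (All.universal fibre≤1 ys))
    where
    fibre≤1 : ∀ b → length (fibre _≟_ (λ x → x) b xs) ≤ 1
    fibre≤1 b = go (Unique.filter⁺ (λ x → x ≟ b) uniq) (All.all-filter (λ x → x ≟ b) xs)
      where
      go : ∀ {ys} → Unique ys → All (_≡ b) ys → length ys ≤ 1
      go {[]} _ _ = z≤n
      go {_ ∷ []} _ _ = s≤s z≤n
      go {_ ∷ _ ∷ _} ((x≢y ∷ _) ∷ _) (ex ∷ ey ∷ _) = contradiction (trans ex (sym ey)) x≢y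

  unique-map : {A B : Set} {P : A → Set} {f : A → B} →
    (∀ {x y} → P x → P y → f x ≡ f y → x ≡ y) →
    ∀ {xs} → All P xs → Unique xs → Unique (map f xs)
  unique-map inj [] [] = []
  unique-map inj (px ∷ pxs) (x∉ ∷ uniq) =
    All.map⁺ (All.map (λ (x≢y , py) e → x≢y (inj px py e)) (All.zip (x∉ , pxs))) ∷ unique-map inj pxs uniq

-- The divisor bound τ(n) = n^o(1).

module DivisorBound where
  open import Data.Nat using (_+_; _*_; _^_; _<_)
  open import Data.Nat.Divisibility using (_∣_; divides)
  open Counting

  -- Only an upper bound for the number of divisors matters, so a covering list may repeat entries;
  -- products can then be treated without any coprimality.
  Covers : List ℕ → ℕ → Set
  Covers ds n = ∀ {d} → d ∣ n → d ∈ˡ ds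

  -- A divisor d of m n splits as g e with g = gcd(d, m); here e is coprime to m / g and divides (m
  -- / g) n, hence divides n.
  covers-* : ∀ {ds es m n} .{{_ : NonZero m}} → Covers ds m → Covers es n →
    Covers (cartesianProductWith _*_ ds es) (m * n)
  covers-* {ds} {es} {m} {n} ds-m es-n {d} d∣mn =
    subst (_∈ˡ cartesianProductWith _*_ ds es) (sym (trans (ℕ∣.m∣n⇒n≡quotient*m g∣d) (ℕ.*-comm e g)))
      (∈.∈-cartesianProductWith⁺ _*_ (ds-m (ℕ.gcd[m,n]∣n d m)) (es-n e∣n))
    where
    g = ℕ.gcd d m
    g∣d = ℕ.gcd[m,n]∣m d m
    e = ℕ∣.quotient g∣d
    g≢0 : NonZero g
    g≢0 = ℕ.≢-nonZero (ℕ.gcd[m,n]≢0 d m (inj₂ (ℕ.≢-nonZero⁻¹ m)))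
    g∣m = ℕ.gcd[m,n]∣n d m
    m′ = ℕ∣.quotient g∣m
    coprime : Coprime.Coprime e m′
    coprime = subst₂ Coprime.Coprime
      (ℕ∣.n/m≡quotient g∣d {{g≢0}}) (ℕ∣.n/m≡quotient g∣m {{g≢0}})
      (Coprime.coprime-/gcd d m {{g≢0}})
    e∣n : e ∣ n
    e∣n = Coprime.coprime-divisor coprime
      (ℕ∣.*-cancelˡ-∣ g {{g≢0}} (subst₂ _∣_
        (trans (ℕ∣.m∣n⇒n≡quotient*m g∣d) (ℕ.*-comm e g))
        (trans (cong (_* n) (trans (ℕ∣.m∣n⇒n≡quotient*m g∣m) (ℕ.*-comm m′ g))) (ℕ.*-assoc g m′ n))
        d∣mn))

  covers-prime : ∀ {p} → Prime p → Covers (1 ∷ p ∷ []) p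
  covers-prime pr d∣p with Prime.prime⇒irreducible pr d∣p
  ... | inj₁ refl = here refl
  ... | inj₂ refl = there (here refl)

  covers-prime-power : ∀ {p} → Prime p → ∀ e → Covers (map (p ^_) (upTo (suc e))) (p ^ e)
  covers-prime-power {p} pr e d∣ with power e d∣
    where
    power : ∀ e {d} → d ∣ p ^ e → ∃[ i ] i ≤ e × d ≡ p ^ i
    power zero d∣1 = 0 , z≤n , ℕ∣.∣1⇒≡1 d∣1
    power (suc e) {d} d∣ with p ℕ∣.∣? d
    ... | yes (divides q refl) with power e {q} (ℕ∣.*-cancelˡ-∣ p {{prime⇒nonZero pr}}
          (subst (_∣ p ^ suc e) (ℕ.*-comm q p) d∣))
    ...   | i , i≤e , refl = suc i , s≤s i≤e , ℕ.*-comm (p ^ i) p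
    power (suc e) {d} d∣ | no p∤d with power e {d} (Coprime.coprime-divisor coprime d∣)
      where
      coprime : Coprime.Coprime d p
      coprime (k∣d , k∣p) with Prime.prime⇒irreducible pr k∣p
      ... | inj₁ k≡1  = k≡1
      ... | inj₂ refl = contradiction k∣d p∤d
    ...   | i , i≤e , eq = i , ℕ.m≤n⇒m≤1+n i≤e , eq
  ... | i , i≤e , refl = ∈.∈-map⁺ (p ^_) (∈.∈-upTo⁺ (s≤s i≤e))

  n<2^n : ∀ n → n < 2 ^ n
  n<2^n zero = s≤s z≤n
  n<2^n (suc n) = begin-strict
    suc n             ≤⟨ n<2^n n ⟩
    2 ^ n             <⟨ ℕ.m<n+m (2 ^ n) (ℕ.m^n>0 2 n) ⟩
    2 ^ n + 2 ^ n     ≡⟨ cong (λ i → 2 ^ n + i) (sym (ℕ.+-identityʳ _)) ⟩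
    2 ^ suc n         ∎
    where open ℕ.≤-Reasoning

  ^-distribʳ-* : ∀ k m n → (m * n) ^ k ≡ m ^ k * n ^ k
  ^-distribʳ-* zero m n = refl
  ^-distribʳ-* (suc k) m n rewrite ^-distribʳ-* k m n = ℕ.[m*n]*[o*p]≡[m*o]*[n*p] m n (m ^ k) (n ^ k)

  -- With q the integer part of e / k one has e + 1 ≤ k (q + 1) ≤ k 2^q, and the k-th power of 2^q
  -- is at most 2^e.
  exponential-bound : ∀ k .{{_ : NonZero k}} e → suc e ^ k ≤ k ^ k * 2 ^ e
  exponential-bound k e = begin
    suc e ^ k             ≤⟨ ℕ.^-monoˡ-≤ k suc-e≤ ⟩
    (k * 2 ^ q) ^ k       ≡⟨ ^-distribʳ-* k k (2 ^ q) ⟩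
    k ^ k * (2 ^ q) ^ k   ≡⟨ cong (k ^ k *_) (ℕ.^-*-assoc 2 q k) ⟩
    k ^ k * 2 ^ (q * k)   ≤⟨ ℕ.*-monoʳ-≤ (k ^ k) (ℕ.^-monoʳ-≤ 2 (DivMod.m/n*n≤m e k)) ⟩
    k ^ k * 2 ^ e         ∎
    where
    open ℕ.≤-Reasoning
    q = e ℕ./ k
    suc-e≤ : suc e ≤ k * 2 ^ q
    suc-e≤ = begin
      suc e                   ≡⟨ cong suc (DivMod.m≡m%n+[m/n]*n e k) ⟩
      suc (e ℕ.% k) + q * k   ≤⟨ ℕ.+-monoˡ-≤ (q * k) (DivMod.m%n<n e k) ⟩
      suc q * k               ≤⟨ ℕ.*-monoˡ-≤ k (n<2^n q) ⟩
      2 ^ q * k               ≡⟨ ℕ.*-comm (2 ^ q) k ⟩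
      k * 2 ^ q               ∎

  extract-power : ∀ m .{{_ : NonTrivial m}} n .{{_ : NonZero n}} →
    ∃[ e ] ∃[ n′ ] n ≡ m ^ e * n′ × ¬ m ∣ n′
  extract-power m n = <-rec (λ n → .{{NonZero n}} → Extract n) step n
    where
    Extract : ℕ → Set
    Extract n = ∃[ e ] ∃[ n′ ] n ≡ m ^ e * n′ × ¬ m ∣ n′
    step : ∀ n → (∀ {l} → l < n → .{{NonZero l}} → Extract l) → .{{NonZero n}} → Extract n
    step n rec with m ℕ∣.∣? n
    ... | no m∤n = 0 , n , sym (ℕ.+-identityʳ n) , m∤n
    ... | yes m∣n with rec (ℕ∣.quotient-< m∣n) {{ℕ∣.quotient≢0 m∣n}}
    ... | e , n′ , eq , m∤n′ = suc e , n′ ,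
      trans (ℕ∣.m∣n⇒n≡m*quotient m∣n) (trans (cong (m *_) eq) (sym (ℕ.*-assoc m (m ^ e) n′))) , m∤n′

  -- The bound τ(n) ≪ n^(1/k) with the root cleared; in this form it multiplies along
  -- factorisations.
  FewDivisors : (k C n : ℕ) → Set
  FewDivisors k C n = ∃[ ds ] Covers ds n × length ds ^ k ≤ C * n

  fewDivisors-* : ∀ {k C D m n} .{{_ : NonZero m}} → FewDivisors k C m → FewDivisors k D n →
    FewDivisors k (C * D) (m * n)
  fewDivisors-* {k} {C} {D} {m} {n} (ds , ds-m , ds≤) (es , es-n , es≤) =
    cartesianProductWith _*_ ds es , covers-* ds-m es-n , (begin
      length (cartesianProductWith _*_ ds es) ^ k
        ≡⟨ cong (_^ k) (length-cartesianProductWith _*_ ds es) ⟩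
      (length ds * length es) ^ k   ≡⟨ ^-distribʳ-* k (length ds) (length es) ⟩
      length ds ^ k * length es ^ k ≤⟨ ℕ.*-mono-≤ ds≤ es≤ ⟩
      C * m * (D * n)               ≡⟨ ℕ.[m*n]*[o*p]≡[m*o]*[n*p] C m D n ⟩
      C * D * (m * n)               ∎)
    where open ℕ.≤-Reasoning

  -- A 2ᵏ-rough prime p satisfies τ(p)ᵏ = 2ᵏ ≤ p.
  very-rough : ∀ k n .{{_ : NonZero n}} → (2 ^ k) Rough n → FewDivisors k 1 n
  very-rough k = <-rec (λ n → .{{NonZero n}} → (2 ^ k) Rough n → FewDivisors k 1 n) step
    where
    step : ∀ n → (∀ {l} → l < n → .{{NonZero l}} → (2 ^ k) Rough l → FewDivisors k 1 l) →
      .{{NonZero n}} → (2 ^ k) Rough n → FewDivisors k 1 n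
    step 1 _ _ = 1 ∷ [] , (λ d∣1 → here (ℕ∣.∣1⇒≡1 d∣1)) , ℕ.≤-reflexive (ℕ.^-zeroˡ k)
    step n@(suc (suc _)) rec rough with Prime.composite? n
    ... | no ¬c = 1 ∷ n ∷ [] , covers-prime (prime ¬c) ,
      ℕ.≤-trans (Prime.rough⇒≤ rough) (ℕ.≤-reflexive (sym (ℕ.*-identityˡ n)))
    ... | yes (Prime.composite {d} d<n d∣n) =
      subst (FewDivisors k 1) (sym (ℕ∣.m∣n⇒n≡quotient*m d∣n))
        (fewDivisors-* {k} {1} {1} {ℕ∣.quotient d∣n} {{q≢0}}
          (rec (ℕ∣.quotient-< d∣n) {{q≢0}} (Prime.rough∧∣⇒rough rough (ℕ∣.quotient-∣ d∣n)))
          (rec d<n {{d≢0}} (Prime.rough∧∣⇒rough rough d∣n)))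
      where
      q≢0 = ℕ∣.quotient≢0 d∣n
      d≢0 = ℕ.nonTrivial⇒nonZero d

  -- A sieve descending from 2ᵏ to m: splitting off the full power of m leaves a number that is
  -- rough for m + 1. Each of the i values of m costs a factor kᵏ, so the constant depends on k
  -- alone.
  rough : ∀ k .{{_ : NonZero k}} i {m} → i + m ≡ 2 ^ k → 2 ≤ m →
    ∃[ C ] (∀ n → .{{NonZero n}} → m Rough n → FewDivisors k C n)
  rough k zero refl _ = 1 , very-rough k
  rough k (suc i) {m} eq 2≤m with rough k i (trans (ℕ.+-suc i m) eq) (ℕ.m≤n⇒m≤1+n 2≤m)
  ... | C , few = k ^ k * C , step
    where
    instance m-nonTrivial = ℕ.n>1⇒nonTrivial 2≤m
    step : ∀ n → .{{NonZero n}} → m Rough n → FewDivisors k (k ^ k * C) n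
    step n m-rough with extract-power m n
    ... | e , n′ , refl , m∤n′ =
      fewDivisors-* {k} {k ^ k} {{m^e≢0}} (power e m-rough)
        (few n′ {{ℕ.m*n≢0⇒n≢0 (m ^ e)}} (Prime.∤⇒rough-suc m∤n′
          (Prime.rough∧∣⇒rough m-rough (ℕ∣.n∣m*n (m ^ e)))))
      where
      m^e≢0 = ℕ.m^n≢0 m e {{ℕ.nonTrivial⇒nonZero m}}
      power : ∀ e → m Rough (m ^ e * n′) → FewDivisors k (k ^ k) (m ^ e)
      power zero _ = 1 ∷ [] , (λ d∣1 → here (ℕ∣.∣1⇒≡1 d∣1)) ,
        ℕ.≤-trans (ℕ.≤-reflexive (ℕ.^-zeroˡ k))
          (ℕ.≤-trans (ℕ.m^n>0 k k) (ℕ.≤-reflexive (sym (ℕ.*-identityʳ _))))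
      -- Here m divides an m-rough number, so m is prime and the powers of m are all the divisors of
      -- m^e.
      power e@(suc e′) rough′ = map (m ^_) (upTo (suc e)) , covers-prime-power m-prime e , (begin
        length (map (m ^_) (upTo (suc e))) ^ k
          ≡⟨ cong (_^ k) (trans (List.length-map (m ^_) (upTo (suc e))) (List.length-upTo (suc e))) ⟩
        suc e ^ k        ≤⟨ exponential-bound k e ⟩
        k ^ k * 2 ^ e    ≤⟨ ℕ.*-monoʳ-≤ (k ^ k) (ℕ.^-monoˡ-≤ e 2≤m) ⟩
        k ^ k * m ^ e    ∎)
        where
        open ℕ.≤-Reasoning
        m-prime = Prime.rough∧∣⇒prime rough′ (ℕ∣.∣m⇒∣m*n n′ (ℕ∣.m∣m*n (m ^ e′)))

  few-divisors : ∀ k .{{_ : NonZero k}} → ∃[ C ] (∀ n → .{{NonZero n}} → FewDivisors k C n)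
  few-divisors k with rough k (2 ^ k ℕ.∸ 2) (ℕ.m∸n+n≡m (ℕ.^-monoʳ-≤ 2 (ℕ.>-nonZero⁻¹ k))) ℕ.≤-refl
  ... | C , few = C , λ n → few n Prime.2-rough

-- Divisibility and squares in ℤ.

module Integers where
  open import Data.Integer using (_+_; _*_; ∣_∣; 0ℤ)
  open import Data.Integer.Divisibility.Signed using (_∣_; divides)

  nonZero : ∀ {i} → i ≢ 0ℤ → ℤ.NonZero i
  nonZero = ℤ.≢-nonZero

  *-≢0 : ∀ {i j} → i ≢ 0ℤ → j ≢ 0ℤ → i * j ≢ 0ℤ
  *-≢0 {i} i≢0 j≢0 eq with ℤ.i*j≡0⇒i≡0∨j≡0 i eq
  ... | inj₁ e = i≢0 e
  ... | inj₂ e = j≢0 e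

  *-cancelˡ : ∀ {i j k} → i ≢ 0ℤ → i * j ≡ i * k → j ≡ k
  *-cancelˡ {i} {j} {k} i≢0 = ℤ.*-cancelˡ-≡ i j k {{nonZero i≢0}}

  i*i≡0⇒i≡0 : ∀ {i} → i * i ≡ 0ℤ → i ≡ 0ℤ
  i*i≡0⇒i≡0 {i} eq with ℤ.i*j≡0⇒i≡0∨j≡0 i eq
  ... | inj₁ e = e
  ... | inj₂ e = e

  euclid : ∀ {p} → Prime p → ∀ i j → + p ∣ i * j → (+ p ∣ i) ⊎ (+ p ∣ j)
  euclid p-prime i j p∣ij
    with Prime.euclidsLemma ∣ i ∣ ∣ j ∣ p-prime (subst (_ ℕ∣.∣_) (ℤ.abs-* i j) (ℤ∣.∣⇒∣ᵤ p∣ij))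
  ... | inj₁ q = inj₁ (ℤ∣.∣ᵤ⇒∣ q)
  ... | inj₂ q = inj₂ (ℤ∣.∣ᵤ⇒∣ q)

  ∣∧<⇒≡0 : ∀ {n i} → + n ∣ i → ∣ i ∣ ℕ.< n → i ≡ 0ℤ
  ∣∧<⇒≡0 {n} {i} n∣i i<n with ∣ i ∣ in eq
  ... | zero  = ℤ.∣i∣≡0⇒i≡0 eq
  ... | suc m = contradiction (ℕ∣.∣⇒≤ (subst (n ℕ∣.∣_) eq (ℤ∣.∣⇒∣ᵤ n∣i))) (ℕ.<⇒≱ i<n)

  private
    -- After division by the gcd, k′ is coprime to m′ and still divides m′², which leaves only k′ =
    -- 1.
    squares-∣ : ∀ {k m} .{{_ : NonZero k}} → k ℕ.* k ℕ∣.∣ m ℕ.* m → k ℕ∣.∣ m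
    squares-∣ {k} {m} k²∣m² = subst (ℕ∣._∣ m) g≡k (ℕ.gcd[m,n]∣m m k)
      where
      g = ℕ.gcd m k
      instance
        g≢0 : NonZero g
        g≢0 = ℕ.≢-nonZero (ℕ.gcd[m,n]≢0 m k (inj₂ (ℕ.≢-nonZero⁻¹ k)))
        g²≢0 : NonZero (g ℕ.* g)
        g²≢0 = ℕ.m*n≢0 g g
      m′ = m ℕ./ g
      k′ = k ℕ./ g
      m≡ : m ≡ m′ ℕ.* g
      m≡ = sym (DivMod.m/n*n≡m (ℕ.gcd[m,n]∣m m k))
      k≡ : k ≡ k′ ℕ.* g
      k≡ = sym (DivMod.m/n*n≡m (ℕ.gcd[m,n]∣n m k))
      coprime : Coprime.Coprime k′ m′
      coprime = Coprime.sym (Coprime.coprime-/gcd m k)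
      square : ∀ n n′ → n ≡ n′ ℕ.* g → n ℕ.* n ≡ (n′ ℕ.* n′) ℕ.* (g ℕ.* g)
      square n n′ e = trans (cong₂ ℕ._*_ e e) (ℕ.[m*n]*[o*p]≡[m*o]*[n*p] n′ g n′ g)
      k′²∣m′² : k′ ℕ.* k′ ℕ∣.∣ m′ ℕ.* m′
      k′²∣m′² = ℕ∣.*-cancelʳ-∣ (g ℕ.* g) (subst₂ ℕ∣._∣_ (square k k′ k≡) (square m m′ m≡) k²∣m²)
      k′∣m′ : k′ ℕ∣.∣ m′
      k′∣m′ = Coprime.coprime-divisor coprime (ℕ∣.m*n∣⇒m∣ k′ k′ k′²∣m′²)
      g≡k : g ≡ k
      g≡k = sym (trans k≡ (trans (cong (ℕ._* g) (coprime (ℕ∣.∣-refl , k′∣m′))) (ℕ.*-identityˡ g)))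

  -- An integer that is the square of the rational number m / k is the square of an integer, because
  -- k² ∣ m² gives k ∣ m.
  square-quotient : ∀ {m k D} → k ≢ 0ℤ → m * m ≡ D * (k * k) → ∃[ e ] D ≡ e * e
  square-quotient {m} {k} {D} k≢0 eq = from-quotient (ℤ∣.∣ᵤ⇒∣ {k} {m}
    (squares-∣ {∣ k ∣} {∣ m ∣} {{nonZero k≢0}}
      (subst₂ ℕ∣._∣_ (ℤ.abs-* k k) (trans (cong ∣_∣ (sym eq)) (ℤ.abs-* m m))
        (ℤ∣.∣⇒∣ᵤ (divides {k = k * k} D refl)))))
    where
    rearrange : ∀ e k → e * k * (e * k) ≡ k * k * (e * e)
    rearrange = solve-∀
    from-quotient : k ∣ m → ∃[ e ] D ≡ e * e
    from-quotient (divides e m≡ek) = e , *-cancelˡ (*-≢0 k≢0 k≢0)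
      (trans (ℤ.*-comm (k * k) D) (trans (sym eq) (trans (cong₂ _*_ m≡ek m≡ek) (rearrange e k))))

-- Symmetric functions of triples and the identities behind the two choices of f.

module Triples where
  open import Data.Integer using (_+_; _-_; _*_; -_; ∣_∣; 0ℤ)
  open import Data.Integer.Divisibility.Signed using (_∣_)
  open Integers
  open Counting

  Triple : Set
  Triple = ℤ × ℤ × ℤ

  e₁ e₂ e₃ : Triple → ℤ
  e₁ (x₁ , x₂ , x₃) = x₁ + x₂ + x₃
  e₂ (x₁ , x₂ , x₃) = x₁ * x₂ + x₁ * x₃ + x₂ * x₃
  e₃ (x₁ , x₂ , x₃) = x₁ * x₂ * x₃

  ∏ : (ℤ → ℤ) → Triple → ℤ
  ∏ f (x₁ , x₂ , x₃) = f x₁ * f x₂ * f x₃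

  -- The coefficients of ∏ (X + xᵢ) - ∏ (X + yᵢ), where the cubic terms cancel.
  c₂ c₁ c₀ : Triple → Triple → ℤ
  c₂ x y = e₁ x - e₁ y
  c₁ x y = e₂ x - e₂ y
  c₀ x y = e₃ x - e₃ y

  ∏-shift : ∀ Λ x y → ∏ (λ z → Λ + z) x - ∏ (λ z → Λ + z) y ≡
    c₂ x y * (Λ * Λ) + c₁ x y * Λ + c₀ x y
  ∏-shift Λ (x₁ , x₂ , x₃) (y₁ , y₂ , y₃) = identity Λ x₁ x₂ x₃ y₁ y₂ y₃
    where
    identity : ∀ Λ x₁ x₂ x₃ y₁ y₂ y₃ →
      (Λ + x₁) * (Λ + x₂) * (Λ + x₃) - (Λ + y₁) * (Λ + y₂) * (Λ + y₃) ≡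
      (x₁ + x₂ + x₃ - (y₁ + y₂ + y₃)) * (Λ * Λ) +
      (x₁ * x₂ + x₁ * x₃ + x₂ * x₃ - (y₁ * y₂ + y₁ * y₃ + y₂ * y₃)) * Λ +
      (x₁ * x₂ * x₃ - y₁ * y₂ * y₃)
    identity = solve-∀

  -- The bracket on the right is u² times the value of `∏ (X + xᵢ) - ∏ (X + yᵢ)` at X = -v / u, so
  -- the two products agree as soon as that difference has the root of u X + v.
  ∏-linear : ∀ u v x y → ∏ (λ z → u * z - v) x - ∏ (λ z → u * z - v) y ≡
    u * (c₂ x y * (v * v) - c₁ x y * (u * v) + c₀ x y * (u * u))
  ∏-linear u v (x₁ , x₂ , x₃) (y₁ , y₂ , y₃) = identity u v x₁ x₂ x₃ y₁ y₂ y₃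
    where
    identity : ∀ u v x₁ x₂ x₃ y₁ y₂ y₃ →
      (u * x₁ - v) * (u * x₂ - v) * (u * x₃ - v) - (u * y₁ - v) * (u * y₂ - v) * (u * y₃ - v) ≡
      u * ((x₁ + x₂ + x₃ - (y₁ + y₂ + y₃)) * (v * v) -
           (x₁ * x₂ + x₁ * x₃ + x₂ * x₃ - (y₁ * y₂ + y₁ * y₃ + y₂ * y₃)) * (u * v) +
           (x₁ * x₂ * x₃ - y₁ * y₂ * y₃) * (u * u))
    identity = solve-∀

  -- This is a X² + b X + c at X = -z; the sign is there because `∏ (X + xᵢ)` has the roots `-xᵢ`.
  quadratic : ℤ → ℤ → ℤ → ℤ → ℤ
  quadratic a b c z = a * (z * z) - b * z + c

  ∏-quadratic-symmetric : ∀ a b c x y → e₁ x ≡ e₁ y → e₂ x ≡ e₂ y → e₃ x ≡ e₃ y →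
    ∏ (quadratic a b c) x ≡ ∏ (quadratic a b c) y
  ∏-quadratic-symmetric a b c x y e₁≡ e₂≡ e₃≡ = trans (expand x)
    (trans (cong₂ (λ s (t , w) → norm s t w) e₁≡ (cong₂ _,_ e₂≡ e₃≡)) (sym (expand y)))
    where
    -- The product of the three quadratic values, rewritten in the elementary symmetric functions s,
    -- t, w.
    norm : ℤ → ℤ → ℤ → ℤ
    norm s t w = a * a * a * w * w - a * a * b * t * w + a * a * c * (t * t - + 2 * s * w)
      + a * b * b * s * w - a * b * c * (s * t - + 3 * w) + a * c * c * (s * s - + 2 * t)
      - b * b * b * w + b * b * c * t - b * c * c * s + c * c * c
    identity : ∀ a b c x y z →
      (a * (x * x) - b * x + c) * (a * (y * y) - b * y + c) * (a * (z * z) - b * z + c) ≡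
      let s = x + y + z ; t = x * y + x * z + y * z ; w = x * y * z in
      a * a * a * w * w - a * a * b * t * w + a * a * c * (t * t - + 2 * s * w)
        + a * b * b * s * w - a * b * c * (s * t - + 3 * w) + a * c * c * (s * s - + 2 * t)
        - b * b * b * w + b * b * c * t - b * c * c * s + c * c * c
    identity = solve-∀
    expand : ∀ x → ∏ (quadratic a b c) x ≡ norm (e₁ x) (e₂ x) (e₃ x)
    expand (x₁ , x₂ , x₃) = identity a b c x₁ x₂ x₃

  ∏-cong : ∀ {f g} → (∀ z → f z ≡ g z) → ∀ x → ∏ f x ≡ ∏ g x
  ∏-cong f≡g (x₁ , x₂ , x₃) = cong₂ _*_ (cong₂ _*_ (f≡g x₁) (f≡g x₂)) (f≡g x₃)

  -- Q = ∏ (X + xᵢ) - ∏ (X + yᵢ) has Q(-xᵢ) = ∏ⱼ (xᵢ - yⱼ) and Q(-yᵢ) = ∏ⱼ (xⱼ - yᵢ), so both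
  -- sides equal the product of all nine differences.
  ∏-difference : ∀ x y → let Q = quadratic (c₂ x y) (c₁ x y) (c₀ x y) in ∏ Q x ≡ ∏ Q y
  ∏-difference x@(x₁ , x₂ , x₃) y@(y₁ , y₂ , y₃) = begin
    ∏ Q x
      ≡⟨ ∏-cong (split x₁ x₂ x₃ y₁ y₂ y₃) x ⟩
    (X x₁ + Y x₁) * (X x₂ + Y x₂) * (X x₃ + Y x₃)
      ≡⟨ cong₂ _*_ (cong₂ _*_ (cong (_+ Y x₁) (zero₁ x₁ (x₂ - x₁) (x₃ - x₁)))
                             (cong (_+ Y x₂) (zero₂ x₂ (x₁ - x₂) (x₃ - x₂))))
           (cong (_+ Y x₃) (zero₃ x₃ (x₁ - x₃) (x₂ - x₃))) ⟩
    (0ℤ + Y x₁) * (0ℤ + Y x₂) * (0ℤ + Y x₃)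
      ≡⟨ transpose (x₁ - y₁) (x₁ - y₂) (x₁ - y₃) (x₂ - y₁) (x₂ - y₂) (x₂ - y₃) (x₃ - y₁) (x₃ - y₂) (x₃ - y₃) ⟩
    (X y₁ + 0ℤ) * (X y₂ + 0ℤ) * (X y₃ + 0ℤ)
      ≡⟨ sym (cong₂ _*_ (cong₂ _*_ (cong (λ i → X y₁ + i) (zero₁ y₁ (y₁ - y₂) (y₁ - y₃)))
                                  (cong (λ i → X y₂ + i) (zero₂ y₂ (y₂ - y₁) (y₂ - y₃))))
           (cong (λ i → X y₃ + i) (zero₃ y₃ (y₃ - y₁) (y₃ - y₂)))) ⟩
    (X y₁ + Y y₁) * (X y₂ + Y y₂) * (X y₃ + Y y₃)
      ≡⟨ sym (∏-cong (split x₁ x₂ x₃ y₁ y₂ y₃) y) ⟩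
    ∏ Q y ∎
    where
    open ≡-Reasoning
    Q X Y : ℤ → ℤ
    Q = quadratic (c₂ x y) (c₁ x y) (c₀ x y)
    X z = (x₁ - z) * (x₂ - z) * (x₃ - z)
    Y z = (z - y₁) * (z - y₂) * (z - y₃)
    split : ∀ x₁ x₂ x₃ y₁ y₂ y₃ z →
      (x₁ + x₂ + x₃ - (y₁ + y₂ + y₃)) * (z * z)
        - (x₁ * x₂ + x₁ * x₃ + x₂ * x₃ - (y₁ * y₂ + y₁ * y₃ + y₂ * y₃)) * z
        + (x₁ * x₂ * x₃ - y₁ * y₂ * y₃) ≡
      (x₁ - z) * (x₂ - z) * (x₃ - z) + (z - y₁) * (z - y₂) * (z - y₃)
    split = solve-∀
    zero₁ : ∀ i j k → (i - i) * j * k ≡ 0ℤ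
    zero₁ = solve-∀
    zero₂ : ∀ i j k → j * (i - i) * k ≡ 0ℤ
    zero₂ = solve-∀
    zero₃ : ∀ i j k → j * k * (i - i) ≡ 0ℤ
    zero₃ = solve-∀
    transpose : ∀ a b c d e f g h i →
      (0ℤ + a * b * c) * (0ℤ + d * e * f) * (0ℤ + g * h * i) ≡
      (a * d * g + 0ℤ) * (b * e * h + 0ℤ) * (c * f * i + 0ℤ)
    transpose = solve-∀

  scale-∏ : ∀ a f x → a * a * a * ∏ f x ≡ ∏ (λ z → a * f z) x
  scale-∏ a f (x₁ , x₂ , x₃) = identity a (f x₁) (f x₂) (f x₃)
    where
    identity : ∀ a b c d → a * a * a * (b * c * d) ≡ a * b * (a * c) * (a * d)
    identity = solve-∀

  -- If `c₂ x y` vanishes, so do the other coefficients, and x and y have the same symmetric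
  -- functions. Otherwise (a, b, c) is a rational multiple of the difference polynomial of this very
  -- x, for which `∏-difference` applies.
  ∏-quadratic-proportional : ∀ a b c x y → a ≢ 0ℤ →
    a * c₁ x y ≡ c₂ x y * b → a * c₀ x y ≡ c₂ x y * c →
    ∏ (quadratic a b c) x ≡ ∏ (quadratic a b c) y
  ∏-quadratic-proportional a b c x y a≢0 b∝ c∝ with c₂ x y ℤ.≟ 0ℤ
  ... | yes q₂≡0 = ∏-quadratic-symmetric a b c x y (ℤ.i-j≡0⇒i≡j _ _ q₂≡0)
        (ℤ.i-j≡0⇒i≡j _ _ (vanish b∝)) (ℤ.i-j≡0⇒i≡j _ _ (vanish c∝))
    where
    vanish : ∀ {d r} → a * d ≡ c₂ x y * r → d ≡ 0ℤ
    vanish {d} {r} eq = *-cancelˡ a≢0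
      (trans eq (trans (cong (_* r) q₂≡0) (sym (ℤ.*-zeroʳ a))))
  ... | no q₂≢0 = *-cancelˡ (*-≢0 (*-≢0 q₂≢0 q₂≢0) q₂≢0)
        (trans (exchange x) (trans (cong (a * a * a *_) (∏-difference x y)) (sym (exchange y))))
    where
    q₂ = c₂ x y
    q₁ = c₁ x y
    q₀ = c₀ x y
    expand₁ : ∀ q a b c z → q * (a * (z * z) - b * z + c) ≡ q * a * (z * z) - q * b * z + q * c
    expand₁ = solve-∀
    expand₂ : ∀ q a q₁ q₀ z → q * a * (z * z) - a * q₁ * z + a * q₀ ≡ a * (q * (z * z) - q₁ * z + q₀)
    expand₂ = solve-∀
    pointwise : ∀ z → q₂ * quadratic a b c z ≡ a * quadratic q₂ q₁ q₀ z
    pointwise z = trans (expand₁ q₂ a b c z)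
      (trans (cong₂ (λ r s → q₂ * a * (z * z) - r * z + s) (sym b∝) (sym c∝)) (expand₂ q₂ a q₁ q₀ z))
    exchange : ∀ w → q₂ * q₂ * q₂ * ∏ (quadratic a b c) w ≡ a * a * a * ∏ (quadratic q₂ q₁ q₀) w
    exchange w = trans (scale-∏ q₂ (quadratic a b c) w)
      (trans (∏-cong pointwise w) (sym (scale-∏ a (quadratic q₂ q₁ q₀) w)))

  linear-2-1 : ∀ {u} v → u ≢ 0ℤ → AtMost2-1 (λ z → u * z - v)
  linear-2-1 {u} v u≢0 {x} {y} fx≡fy _ = inj₁ (*-cancelˡ u≢0
    (ℤ.i-j≡0⇒i≡j _ _ (trans (identity (u * x) (u * y) v) (ℤ.i≡j⇒i-j≡0 fx≡fy))))
    where
    identity : ∀ i j v → i - j ≡ i - v - (j - v)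
    identity = solve-∀

  -- Equal values at x ≠ y force a (x + y) = b, which determines y from x.
  quadratic-2-1 : ∀ {a} b c → a ≢ 0ℤ → AtMost2-1 (quadratic a b c)
  quadratic-2-1 {a} b c a≢0 {x} {y} {z} fx≡fy fx≡fz =
    [ (λ e → inj₁ (ℤ.i-j≡0⇒i≡j x y e))
    , (λ e → [ (λ e′ → inj₂ (inj₁ (ℤ.i-j≡0⇒i≡j x z e′)))
             , (λ e′ → inj₂ (inj₂ (*-cancelˡ a≢0 (ℤ.i-j≡0⇒i≡j (a * y) (a * z)
                 (trans (identity₂ a b x y z) (cong₂ _-_ e e′))))))
             ]′ (ℤ.i*j≡0⇒i≡0∨j≡0 (x - z) (difference x z fx≡fz)))
    ]′ (ℤ.i*j≡0⇒i≡0∨j≡0 (x - y) (difference x y fx≡fy))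
    where
    identity₁ : ∀ a b c x y → (x - y) * (a * (x + y) - b) ≡ a * (x * x) - b * x + c - (a * (y * y) - b * y + c)
    identity₁ = solve-∀
    identity₂ : ∀ a b x y z → a * y - a * z ≡ (a * (x + y) - b) - (a * (x + z) - b)
    identity₂ = solve-∀
    difference : ∀ x y → quadratic a b c x ≡ quadratic a b c y → (x - y) * (a * (x + y) - b) ≡ 0ℤ
    difference x y eq = trans (identity₁ a b c x y) (ℤ.i≡j⇒i-j≡0 eq)

-- Size bounds k Hⁿ, with n the weight of an expression in the box size H.

module Bounds (H : ℕ) {{_ : NonZero H}} where
  open import Data.Integer using (_+_; _-_; _*_; -_; ∣_∣)

  infix 4 _≲_^_
  record _≲_^_ (i : ℤ) (k n : ℕ) : Set where
    constructor bound
    field abs≤ : ∣ i ∣ ≤ k ℕ.* H ℕ.^ n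
  open _≲_^_ public

  ≲-mono : ∀ {i k l m n} → k ≤ l → m ≤ n → i ≲ k ^ m → i ≲ l ^ n
  ≲-mono k≤l m≤n (bound b) = bound (ℕ.≤-trans b (ℕ.*-mono-≤ k≤l (ℕ.^-monoʳ-≤ H m≤n)))

  ≲-+ : ∀ {i j k l n} → i ≲ k ^ n → j ≲ l ^ n → i + j ≲ k ℕ.+ l ^ n
  ≲-+ {i} {j} {k} {l} {n} (bound a) (bound b) = bound (ℕ.≤-trans (ℤ.∣i+j∣≤∣i∣+∣j∣ i j)
    (ℕ.≤-trans (ℕ.+-mono-≤ a b) (ℕ.≤-reflexive (sym (ℕ.*-distribʳ-+ (H ℕ.^ n) k l)))))

  ≲-- : ∀ {i j k l n} → i ≲ k ^ n → j ≲ l ^ n → i - j ≲ k ℕ.+ l ^ n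
  ≲-- {i} {j} {k} {l} {n} (bound a) (bound b) = bound (ℕ.≤-trans (ℤ.∣i-j∣≤∣i∣+∣j∣ i j)
    (ℕ.≤-trans (ℕ.+-mono-≤ a b) (ℕ.≤-reflexive (sym (ℕ.*-distribʳ-+ (H ℕ.^ n) k l)))))

  ≲-* : ∀ {i j k l m n} → i ≲ k ^ m → j ≲ l ^ n → i * j ≲ k ℕ.* l ^ (m ℕ.+ n)
  ≲-* {i} {j} {k} {l} {m} {n} (bound a) (bound b) = bound (begin
    ∣ i * j ∣                          ≡⟨ ℤ.abs-* i j ⟩
    ∣ i ∣ ℕ.* ∣ j ∣                      ≤⟨ ℕ.*-mono-≤ a b ⟩
    k ℕ.* H ℕ.^ m ℕ.* (l ℕ.* H ℕ.^ n)  ≡⟨ ℕ.[m*n]*[o*p]≡[m*o]*[n*p] k (H ℕ.^ m) l (H ℕ.^ n) ⟩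
    k ℕ.* l ℕ.* (H ℕ.^ m ℕ.* H ℕ.^ n)  ≡⟨ cong (k ℕ.* l ℕ.*_) (sym (ℕ.^-distribˡ-+-* H m n)) ⟩
    k ℕ.* l ℕ.* H ℕ.^ (m ℕ.+ n)        ∎)
    where open ℕ.≤-Reasoning

  ≲-literal : ∀ k → + k ≲ k ^ 0
  ≲-literal k = bound (ℕ.≤-reflexive (sym (ℕ.*-identityʳ k)))

  ≲-sqrt : ∀ {i k n} → i * i ≲ k ℕ.* k ^ (n ℕ.+ n) → i ≲ k ^ n
  ≲-sqrt {i} {k} {n} (bound b) = bound (ℕ.≮⇒≥ λ kHⁿ<i → ℕ.<⇒≱ (ℕ.*-mono-< kHⁿ<i kHⁿ<i)
    (ℕ.≤-trans (ℕ.≤-reflexive (sym (ℤ.abs-* i i))) (ℕ.≤-trans b (ℕ.≤-reflexive (begin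
      k ℕ.* k ℕ.* H ℕ.^ (n ℕ.+ n)        ≡⟨ cong (k ℕ.* k ℕ.*_) (ℕ.^-distribˡ-+-* H n n) ⟩
      k ℕ.* k ℕ.* (H ℕ.^ n ℕ.* H ℕ.^ n)  ≡⟨ sym (ℕ.[m*n]*[o*p]≡[m*o]*[n*p] k (H ℕ.^ n) k (H ℕ.^ n)) ⟩
      k ℕ.* H ℕ.^ n ℕ.* (k ℕ.* H ℕ.^ n)  ∎)))))
    where open ≡-Reasoning

-- Polynomials with small coefficients and a common root modulo p.

module Concentration
  {p : ℕ} (p-prime : Prime p) (H : ℕ) {{H≢0 : NonZero H}} 
  {c} (2976≤c : 2976 ≤ c) (size : c ℕ.* H ℕ.^ 8 ℕ.< p) (Λ : ℤ)
  where
  open import Data.Integer using (_+_; _-_; _*_; -_; ∣_∣; 0ℤ; 1ℤ)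
  open import Data.Integer.Divisibility.Signed using (_∣_; divides)
  open Integers
  open Counting
  open Triples
  open Bounds H

  -- The two thresholds come from different resultants. The constant 2976 = 6·16² + 6·12·16 + 2·12²
  -- belongs to that of a difference polynomial with a small linear one, of size H⁷; the exponent 8
  -- belongs to that of two difference polynomials, whose constant is only 24² + 72·24 = 2304.
  small : ∀ {i k n} → k ≤ 2976 → n ≤ 8 → i ≲ k ^ n → + p ∣ i → i ≡ 0ℤ
  small k≤ n≤ b p∣i = ∣∧<⇒≡0 p∣i (ℕ.≤-<-trans (abs≤ (≲-mono (ℕ.≤-trans k≤ 2976≤c) n≤ b)) size)

  InBox : Triple → Set
  InBox (x₁ , x₂ , x₃) = x₁ ≲ 1 ^ 1 × x₂ ≲ 1 ^ 1 × x₃ ≲ 1 ^ 1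

  module _ {x y : Triple} (x∈ : InBox x) (y∈ : InBox y) where
    private
      e₁-bound : ∀ {x} → InBox x → e₁ x ≲ 3 ^ 1
      e₁-bound (b₁ , b₂ , b₃) = ≲-+ (≲-+ b₁ b₂) b₃
      e₂-bound : ∀ {x} → InBox x → e₂ x ≲ 3 ^ 2
      e₂-bound (b₁ , b₂ , b₃) = ≲-+ (≲-+ (≲-* b₁ b₂) (≲-* b₁ b₃)) (≲-* b₂ b₃)
      e₃-bound : ∀ {x} → InBox x → e₃ x ≲ 1 ^ 3
      e₃-bound (b₁ , b₂ , b₃) = ≲-* (≲-* b₁ b₂) b₃

    c₂-bound : c₂ x y ≲ 6 ^ 1
    c₂-bound = ≲-- (e₁-bound x∈) (e₁-bound y∈)
    c₁-bound : c₁ x y ≲ 6 ^ 2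
    c₁-bound = ≲-- (e₂-bound x∈) (e₂-bound y∈)
    c₀-bound : c₀ x y ≲ 2 ^ 3
    c₀-bound = ≲-- (e₃-bound x∈) (e₃-bound y∈)

  shifted : Triple → ℤ
  shifted = ∏ (λ z → Λ + z)

  -- u and v are the coefficients of the polynomial u X + v.
  record SmallLinear : Set where
    constructor smallLinear
    field
      {u v}   : ℤ
      u≢0     : u ≢ 0ℤ
      u-bound : u ≲ 12 ^ 2
      v-bound : v ≲ 16 ^ 3
      root    : + p ∣ u * Λ + v

  -- The common target of all cases. The constant is 28³, where 28 = 12 + 16 bounds the values u z -
  -- v of a small linear polynomial in units of H³; quadratic values need only 6 + 6 + 2 = 14.
  record Factoring (xs : List Triple) : Set where
    constructor factoring
    field
      f       : ℤ → ℤ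
      f-2-1   : AtMost2-1 f
      N       : ℤ
      N≢0     : N ≢ 0ℤ
      N-bound : N ≲ 21952 ^ 9
      ∏f≡N    : All (λ x → ∏ f x ≡ N) xs

  module _ (y : Triple) (y∈ : InBox y) (y-unit : ¬ (+ p ∣ shifted y)) where

    Solution : Triple → Set
    Solution x = InBox x × + p ∣ shifted x - shifted y

    private
      P : Triple → ℤ
      P x = c₂ x y * (Λ * Λ) + c₁ x y * Λ + c₀ x y

      root-P : ∀ {x} → Solution x → + p ∣ P x
      root-P {x} (_ , d) = subst (+ p ∣_) (∏-shift Λ x y) d

      ∏≢0 : ∀ f → (∀ z → z ≲ 1 ^ 1 → ¬ (+ p ∣ Λ + z) → f z ≢ 0ℤ) → ∏ f y ≢ 0ℤ
      ∏≢0 f f≢0 = *-≢0 (*-≢0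
        (f≢0 y₁ (proj₁ y∈) (λ d → y-unit (ℤ∣.∣m⇒∣m*n (Λ + y₃) (ℤ∣.∣m⇒∣m*n (Λ + y₂) d))))
        (f≢0 y₂ (proj₁ (proj₂ y∈)) (λ d → y-unit (ℤ∣.∣m⇒∣m*n (Λ + y₃) (ℤ∣.∣n⇒∣m*n (Λ + y₁) d)))))
        (f≢0 y₃ (proj₂ (proj₂ y∈)) (λ d → y-unit (ℤ∣.∣n⇒∣m*n ((Λ + y₁) * (Λ + y₂)) d)))
        where
        y₁ = proj₁ y
        y₂ = proj₁ (proj₂ y)
        y₃ = proj₂ (proj₂ y)

      ∏-bound : ∀ f → (∀ z → z ≲ 1 ^ 1 → f z ≲ 28 ^ 3) → ∏ f y ≲ 21952 ^ 9
      ∏-bound f b = ≲-* (≲-* (b _ (proj₁ y∈)) (b _ (proj₁ (proj₂ y∈)))) (b _ (proj₂ (proj₂ y∈)))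

      -- The last hypothesis says that P x vanishes at -v / u.
      linear-factoring : ∀ {u v} xs → u ≢ 0ℤ → u ≲ 12 ^ 2 → v ≲ 16 ^ 3 →
        (∀ z → z ≲ 1 ^ 1 → ¬ (+ p ∣ Λ + z) → u * z - v ≢ 0ℤ) →
        All (λ x → c₂ x y * (v * v) - c₁ x y * (u * v) + c₀ x y * (u * u) ≡ 0ℤ) xs → Factoring xs
      linear-factoring {u} {v} xs u≢0 u≲ v≲ f≢0 zeros = factoring f (linear-2-1 v u≢0)
        (∏ f y) (∏≢0 f f≢0) (∏-bound f λ z z≲ → ≲-- (≲-* u≲ z≲) v≲)
        (All.map (λ {x} e → ℤ.i-j≡0⇒i≡j _ _
          (trans (∏-linear u v x y) (trans (cong (u *_) e) (ℤ.*-zeroʳ u)))) zeros)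
        where
        f : ℤ → ℤ
        f z = u * z - v

    smallLinear⇒factoring : ∀ {xs} → All Solution xs → SmallLinear → Factoring xs
    smallLinear⇒factoring {xs} sols (smallLinear {u} {v} u≢0 u≲ v≲ p∣uΛ+v) =
      linear-factoring xs u≢0 u≲ v≲ nonvanishing (All.map (λ {x} → resultant x) sols)
      where
      nonvanishing : ∀ z → z ≲ 1 ^ 1 → ¬ (+ p ∣ Λ + z) → u * z - v ≢ 0ℤ
      -- Modulo p, u z - v is congruent to u (Λ + z), and u is nonzero and too small to be divisible
      -- by p.
      nonvanishing z _ p∤ eq =
        [ (λ p∣u → u≢0 (small (ℕ.≤ᵇ⇒≤ 12 2976 _) (ℕ.≤ᵇ⇒≤ 2 8 _) u≲ p∣u)) , p∤ ]′
          (euclid p-prime u (Λ + z) (subst (+ p ∣_) (identity u v z Λ)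
            (ℤ∣.∣m∣n⇒∣m+n p∣uΛ+v (subst (+ p ∣_) (sym eq) (divides 0ℤ refl)))))
        where
        identity : ∀ u v z Λ → u * Λ + v + (u * z - v) ≡ u * (Λ + z)
        identity = solve-∀
      resultant : ∀ x → Solution x → c₂ x y * (v * v) - c₁ x y * (u * v) + c₀ x y * (u * u) ≡ 0ℤ
      -- Division of u² `P x` by u Λ + v with remainder; the remainder, free of Λ, is u² times the
      -- value at -v / u.
      resultant x sol@(x∈ , _) = small (ℕ.≤ᵇ⇒≤ 2976 2976 _) (ℕ.≤ᵇ⇒≤ 7 8 _)
        (≲-+ (≲-- (≲-* (c₂-bound x∈ y∈) (≲-* v≲ v≲)) (≲-* (c₁-bound x∈ y∈) (≲-* u≲ v≲)))
             (≲-* (c₀-bound x∈ y∈) (≲-* u≲ u≲)))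
        (subst (+ p ∣_) (identity (c₂ x y) (c₁ x y) (c₀ x y) u v Λ)
          (ℤ∣.∣m∣n⇒∣m+n (ℤ∣.∣n⇒∣m*n (u * u) (root-P sol))
            (ℤ∣.∣n⇒∣m*n (c₂ x y * (v - u * Λ) - c₁ x y * u) p∣uΛ+v)))
        where
        identity : ∀ a b c u v Λ →
          u * u * (a * (Λ * Λ) + b * Λ + c) + (a * (v - u * Λ) - b * u) * (u * Λ + v) ≡
          a * (v * v) - b * (u * v) + c * (u * u)
        identity = solve-∀

    -- The bounds 12 H² and 16 H³ in `SmallLinear` are made to cover every linear polynomial that is
    -- excluded here: c₁ X + c₀, then p₂ X + (p₁ - p₂ z), and 2 p₂ X + (p₁ ± e) with e² the
    -- discriminant.
    private module NoSmallLinear (none : ¬ SmallLinear) where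

      -- With c₂ = 0 and c₁ ≠ 0, c₁ X + c₀ would itself be a small linear polynomial with root Λ;
      -- with c₁ = 0 too, p divides the small integer c₀.
      c₂≡0⇒rest≡0 : ∀ {x} → Solution x → c₂ x y ≡ 0ℤ → c₁ x y ≡ 0ℤ × c₀ x y ≡ 0ℤ
      c₂≡0⇒rest≡0 {x} sol@(x∈ , _) c₂≡0 with c₁ x y ℤ.≟ 0ℤ
      ... | yes c₁≡0 = c₁≡0 , small (ℕ.≤ᵇ⇒≤ 2 2976 _) (ℕ.≤ᵇ⇒≤ 3 8 _) (c₀-bound x∈ y∈)
        (subst (+ p ∣_) (trans (cong₂ (λ a b → a * (Λ * Λ) + b * Λ + c₀ x y) c₂≡0 c₁≡0) (identity (c₀ x y) Λ))
          (root-P sol))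
        where
        identity : ∀ c Λ → 0ℤ * (Λ * Λ) + 0ℤ * Λ + c ≡ c
        identity = solve-∀
      ... | no c₁≢0 = contradiction
        (smallLinear c₁≢0 (≲-mono (ℕ.≤ᵇ⇒≤ 6 12 _) ℕ.≤-refl (c₁-bound x∈ y∈))
          (≲-mono (ℕ.≤ᵇ⇒≤ 2 16 _) ℕ.≤-refl (c₀-bound x∈ y∈))
          (subst (+ p ∣_) (trans (cong (λ a → a * (Λ * Λ) + c₁ x y * Λ + c₀ x y) c₂≡0)
            (identity (c₁ x y) (c₀ x y) Λ)) (root-P sol)))
        none
        where
        identity : ∀ b c Λ → 0ℤ * (Λ * Λ) + b * Λ + c ≡ b * Λ + c
        identity = solve-∀

      -- All difference polynomials are identically zero, so any linear f has a constant product.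
      -- The choice z - (H + 1) has no zero in the box, which makes N nonzero.
      all-trivial : ∀ {xs} → All Solution xs → All (λ x → c₂ x y ≡ 0ℤ) xs → Factoring xs
      all-trivial {xs} sols c₂≡0 = linear-factoring xs (λ ()) (≲-mono (ℕ.≤ᵇ⇒≤ 1 12 _) z≤n (≲-literal 1))
        v-bound nonvanishing (All.map (λ {x} → zeros x) (All.zip (sols , c₂≡0)))
        where
        v : ℤ
        v = + suc H
        v-bound : v ≲ 16 ^ 3
        v-bound = ≲-mono (ℕ.≤ᵇ⇒≤ 2 16 _) (ℕ.≤ᵇ⇒≤ 1 3 _) (≲-+ (≲-mono ℕ.≤-refl z≤n (≲-literal 1))
          (bound {+ H} {1} {1} (ℕ.≤-reflexive (sym (trans (ℕ.*-identityˡ _) (ℕ.*-identityʳ H))))))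
        nonvanishing : ∀ z → z ≲ 1 ^ 1 → ¬ (+ p ∣ Λ + z) → 1ℤ * z - v ≢ 0ℤ
        nonvanishing z (bound z≤H) _ eq = ℕ.1+n≰n {H} (subst₂ _≤_
          (cong ∣_∣ (trans (sym (ℤ.*-identityˡ z)) (ℤ.i-j≡0⇒i≡j _ _ eq)))
          (trans (ℕ.*-identityˡ _) (ℕ.*-identityʳ H)) z≤H)
        zeros : ∀ x → Solution x × c₂ x y ≡ 0ℤ →
          c₂ x y * (v * v) - c₁ x y * (1ℤ * v) + c₀ x y * (1ℤ * 1ℤ) ≡ 0ℤ
        zeros x (sol , c₂≡0) with c₂≡0⇒rest≡0 sol c₂≡0
        ... | c₁≡0 , c₀≡0 rewrite c₂≡0 | c₁≡0 | c₀≡0 = refl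

      module Base (x : Triple) (x-sol : Solution x) (p₂≢0 : c₂ x y ≢ 0ℤ) where
        x∈ = proj₁ x-sol
        p₂ = c₂ x y
        p₁ = c₁ x y
        p₀ = c₀ x y
        p₂-bound = c₂-bound x∈ y∈
        p₁-bound = c₁-bound x∈ y∈
        p₀-bound = c₀-bound x∈ y∈

        -- If -z were an integer root of the quadratic, X + z would split off. Λ is not a root of X
        -- + z modulo p, so it would be a root of the cofactor p₂ X + (p₁ - p₂ z), which is small.
        nonvanishing : ∀ z → z ≲ 1 ^ 1 → ¬ (+ p ∣ Λ + z) → quadratic p₂ p₁ p₀ z ≢ 0ℤ
        nonvanishing z z≲ p∤ eq = [ p∤ , (λ d → none (smallLinear p₂≢0
            (≲-mono (ℕ.≤ᵇ⇒≤ 6 12 _) (ℕ.≤ᵇ⇒≤ 1 2 _) p₂-bound)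
            (≲-mono (ℕ.≤ᵇ⇒≤ 12 16 _) (ℕ.≤ᵇ⇒≤ 2 3 _) (≲-- p₁-bound (≲-* p₂-bound z≲))) d)) ]′
          (euclid p-prime (Λ + z) (p₂ * Λ + (p₁ - p₂ * z))
            (subst (+ p ∣_) (trans (sym (ℤ.+-identityʳ (P x)))
              (trans (cong (λ i → P x - i) (sym eq)) (identity p₂ p₁ p₀ z Λ))) (root-P x-sol)))
          where
          identity : ∀ a b c z Λ → a * (Λ * Λ) + b * Λ + c - (a * (z * z) - b * z + c) ≡
            (Λ + z) * (a * Λ + (b - a * z))
          identity = solve-∀

        2p₂≢0 = *-≢0 {+ 2} (λ ()) p₂≢0
        2p₂-bound = ≲-mono ℕ.≤-refl (ℕ.≤ᵇ⇒≤ 1 2 _) (≲-* (≲-literal 2) p₂-bound)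

        -- The discriminant is at most (36 + 4·12) H⁴, and 84 is rounded up to the square 100.
        root-bound : ∀ {e} → p₁ * p₁ - + 4 * (p₂ * p₀) ≡ e * e → e ≲ 10 ^ 2
        root-bound {e} disc≡ = ≲-sqrt {e} {10} {2} (subst (_≲ 100 ^ 4) disc≡
          (≲-mono (ℕ.≤ᵇ⇒≤ 84 100 _) ℕ.≤-refl
            (≲-- (≲-* p₁-bound p₁-bound) (≲-* (≲-literal 4) (≲-* p₂-bound p₀-bound)))))

        -- A square discriminant factors 4 p₂ `P x` into 2 p₂ Λ + (p₁ - e) and 2 p₂ Λ + (p₁ + e),
        -- and p divides one of the two.
        discriminant≢square : ∀ e → p₁ * p₁ - + 4 * (p₂ * p₀) ≢ e * e
        discriminant≢square e disc≡ =
          [ (λ d → none (smallLinear 2p₂≢0 2p₂-bound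
              (≲-mono ℕ.≤-refl (ℕ.≤ᵇ⇒≤ 2 3 _) (≲-- p₁-bound (root-bound disc≡))) d))
          , (λ d → none (smallLinear 2p₂≢0 2p₂-bound
              (≲-mono ℕ.≤-refl (ℕ.≤ᵇ⇒≤ 2 3 _) (≲-+ p₁-bound (root-bound disc≡))) d)) ]′
          (euclid p-prime (+ 2 * p₂ * Λ + (p₁ - e)) (+ 2 * p₂ * Λ + (p₁ + e))
            (subst (+ p ∣_) (trans (identity₁ p₂ p₁ p₀ Λ) (trans
              (cong (λ d → (+ 2 * p₂ * Λ + p₁) * (+ 2 * p₂ * Λ + p₁) - d) disc≡)
              (identity₂ (+ 2 * p₂ * Λ) p₁ e))) (ℤ∣.∣n⇒∣m*n (+ 4 * p₂) (root-P x-sol))))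
          where
          identity₁ : ∀ a b c Λ → + 4 * a * (a * (Λ * Λ) + b * Λ + c) ≡
            (+ 2 * a * Λ + b) * (+ 2 * a * Λ + b) - (b * b - + 4 * (a * c))
          identity₁ = solve-∀
          identity₂ : ∀ w b e → (w + b) * (w + b) - e * e ≡ (w + (b - e)) * (w + (b + e))
          identity₂ = solve-∀

        -- P x and P w share the root Λ modulo p, so their resultant d₀² - d₁ d₀₁ vanishes. If
        -- d₁ ≠ 0, the polynomials share the rational root -d₀ / d₁, so the discriminant of P x
        -- is a square; hence d₁ = d₀ = 0.
        proportional : ∀ w → Solution w → p₂ * c₁ w y ≡ c₂ w y * p₁ × p₂ * c₀ w y ≡ c₂ w y * p₀
        proportional w w-sol@(w∈ , _) = ℤ.i-j≡0⇒i≡j _ _ d₁≡0 , ℤ.i-j≡0⇒i≡j _ _ d₀≡0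
          where
          q₂ = c₂ w y
          q₁ = c₁ w y
          q₀ = c₀ w y
          d₀ = p₂ * q₀ - q₂ * p₀
          d₁ = p₂ * q₁ - q₂ * p₁
          d₀₁ = p₁ * q₀ - q₁ * p₀
          resultant≡0 : d₀ * d₀ - d₁ * d₀₁ ≡ 0ℤ
          resultant≡0 = small (ℕ.≤ᵇ⇒≤ 2304 2976 _) ℕ.≤-refl
            (≲-- (≲-* d₀-bound d₀-bound) (≲-* d₁-bound d₀₁-bound))
            (subst (+ p ∣_) (identity p₂ p₁ p₀ q₂ q₁ q₀ Λ)
              -- The combination is (d₀ - d₁ Λ)(p₂ `P w` - q₂ `P x`) + d₁ (q₁ `P x` - p₁ `P w`). The
              -- first difference is d₁ Λ + d₀ and the second is d₁ Λ² - d₀₁, so the powers of Λ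
              -- cancel.
              (ℤ∣.∣m∣n⇒∣m+n
                (ℤ∣.∣n⇒∣m*n (d₁ * q₁ - q₂ * (d₀ - d₁ * Λ)) (root-P x-sol))
                (ℤ∣.∣n⇒∣m*n (p₂ * (d₀ - d₁ * Λ) - d₁ * p₁) (root-P w-sol))))
            where
            q₂-bound = c₂-bound w∈ y∈
            q₁-bound = c₁-bound w∈ y∈
            q₀-bound = c₀-bound w∈ y∈
            d₀-bound : d₀ ≲ 24 ^ 4
            d₀-bound = ≲-- (≲-* p₂-bound q₀-bound) (≲-* q₂-bound p₀-bound)
            d₁-bound : d₁ ≲ 72 ^ 3
            d₁-bound = ≲-- (≲-* p₂-bound q₁-bound) (≲-* q₂-bound p₁-bound)
            d₀₁-bound : d₀₁ ≲ 24 ^ 5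
            d₀₁-bound = ≲-- (≲-* p₁-bound q₀-bound) (≲-* q₁-bound p₀-bound)
            identity : ∀ p₂ p₁ p₀ q₂ q₁ q₀ Λ →
              ((p₂ * q₁ - q₂ * p₁) * q₁ - q₂ * ((p₂ * q₀ - q₂ * p₀) - (p₂ * q₁ - q₂ * p₁) * Λ))
                * (p₂ * (Λ * Λ) + p₁ * Λ + p₀) +
              (p₂ * ((p₂ * q₀ - q₂ * p₀) - (p₂ * q₁ - q₂ * p₁) * Λ) - (p₂ * q₁ - q₂ * p₁) * p₁)
                * (q₂ * (Λ * Λ) + q₁ * Λ + q₀) ≡
              (p₂ * q₀ - q₂ * p₀) * (p₂ * q₀ - q₂ * p₀) - (p₂ * q₁ - q₂ * p₁) * (p₁ * q₀ - q₁ * p₀)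
            identity = solve-∀
          d₁≡0 : d₁ ≡ 0ℤ
          d₁≡0 = decidable-stable (d₁ ℤ.≟ 0ℤ) λ d₁≢0 →
            -- The number p₁ d₁ - 2 p₂ d₀ is d₁ times the derivative 2 p₂ X + p₁ at the common root
            -- X = -d₀ / d₁; at a root the square of the derivative is the discriminant.
            let e , disc≡ = square-quotient {p₁ * d₁ - + 2 * (p₂ * d₀)} {d₁} {p₁ * p₁ - + 4 * (p₂ * p₀)} d₁≢0
                  (trans (identity p₂ p₁ p₀ q₂ q₁ q₀) (trans
                    (cong (λ r → (p₁ * p₁ - + 4 * (p₂ * p₀)) * (d₁ * d₁) + + 4 * (p₂ * p₂) * r) resultant≡0)
                    (drop ((p₁ * p₁ - + 4 * (p₂ * p₀)) * (d₁ * d₁)) (+ 4 * (p₂ * p₂)))))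
            in discriminant≢square e disc≡
            where
            identity : ∀ p₂ p₁ p₀ q₂ q₁ q₀ →
              (p₁ * (p₂ * q₁ - q₂ * p₁) - + 2 * (p₂ * (p₂ * q₀ - q₂ * p₀))) *
              (p₁ * (p₂ * q₁ - q₂ * p₁) - + 2 * (p₂ * (p₂ * q₀ - q₂ * p₀))) ≡
              (p₁ * p₁ - + 4 * (p₂ * p₀)) * ((p₂ * q₁ - q₂ * p₁) * (p₂ * q₁ - q₂ * p₁)) +
              + 4 * (p₂ * p₂) *
              ((p₂ * q₀ - q₂ * p₀) * (p₂ * q₀ - q₂ * p₀) - (p₂ * q₁ - q₂ * p₁) * (p₁ * q₀ - q₁ * p₀))
            identity = solve-∀
            drop : ∀ a b → a + b * 0ℤ ≡ a
            drop = solve-∀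
          d₀≡0 : d₀ ≡ 0ℤ
          d₀≡0 = i*i≡0⇒i≡0 (trans (drop (d₀ * d₀) d₀₁)
            (trans (cong (λ d → d₀ * d₀ - d * d₀₁) (sym d₁≡0)) resultant≡0))
            where
            drop : ∀ a b → a ≡ a - 0ℤ * b
            drop = solve-∀

        quadratic-factoring : ∀ {xs} → All Solution xs → Factoring xs
        quadratic-factoring sols = factoring F (quadratic-2-1 p₁ p₀ p₂≢0) (∏ F y)
          (∏≢0 F nonvanishing)
          (∏-bound F λ z z≲ → ≲-mono (ℕ.≤ᵇ⇒≤ 14 28 _) ℕ.≤-refl
            (≲-+ (≲-- (≲-* p₂-bound (≲-* z≲ z≲)) (≲-* p₁-bound z≲)) p₀-bound))
          (All.map (λ {w} sol → let (b∝ , c∝) = proportional w sol in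
            ∏-quadratic-proportional p₂ p₁ p₀ w y p₂≢0 b∝ c∝) sols)
          where
          F : ℤ → ℤ
          F = quadratic p₂ p₁ p₀

    ¬smallLinear⇒factoring : ∀ {xs} → All Solution xs → ¬ SmallLinear → Factoring xs
    ¬smallLinear⇒factoring {xs} sols none with All.all? (λ x → c₂ x y ℤ.≟ 0ℤ) xs
    ... | yes c₂≡0 = NoSmallLinear.all-trivial none sols c₂≡0
    ... | no ¬all with find (All.¬All⇒Any¬ (λ x → c₂ x y ℤ.≟ 0ℤ) xs ¬all)
    ... | x , x∈xs , p₂≢0 = NoSmallLinear.Base.quadratic-factoring none x (All.lookup sols x∈xs) p₂≢0 sols

-- Counting triples through the divisors of N.

module TripleCounting where
  open import Data.Integer using (_*_; -_; ∣_∣)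
  open import Data.Integer.Divisibility.Signed using (_∣_)
  open Counting
  open DivisorBound
  open Triples

  signed : List ℕ → List ℤ
  signed ds = map (λ d → + d) ds ++ map (λ d → - + d) ds

  length-signed : ∀ ds → length (signed ds) ≡ length ds ℕ.* 2
  length-signed ds = trans (List.length-++ (map (λ d → + d) ds))
    (trans (cong₂ ℕ._+_ (List.length-map (λ d → + d) ds) (List.length-map (λ d → - + d) ds))
      (trans (cong (length ds ℕ.+_) (sym (ℕ.+-identityʳ _))) (ℕ.*-comm 2 (length ds))))

  ∈-signed : ∀ {ds i} → ∣ i ∣ ∈ˡ ds → i ∈ˡ signed ds
  ∈-signed {i = + _}         d∈ = ∈.∈-++⁺ˡ (∈.∈-map⁺ (λ d → + d) d∈)
  ∈-signed {ds} {ℤ.-[1+ n ]} d∈ = ∈.∈-++⁺ʳ (map (λ d → + d) ds) (∈.∈-map⁺ (λ d → - + d) d∈)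

  module _ {f : ℤ → ℤ} (f-2-1 : AtMost2-1 f) {N : ℤ} where

    -- Every f(xᵢ) is a signed divisor of N and f is at most two-to-one, so each coordinate has at
    -- most 2·2·ℓ values; 64 is the cube of this 4.
    triples-bound : ∀ {k C xs} → FewDivisors k C ∣ N ∣ → Unique xs → All (λ x → ∏ f x ≡ N) xs →
      length xs ℕ.^ k ≤ 64 ℕ.^ k ℕ.* (C ℕ.* ∣ N ∣) ℕ.^ 3
    triples-bound {k} {C} {xs} (ds , covers , few) uniq ∏f≡N = begin
      length xs ℕ.^ k                        ≤⟨ ℕ.^-monoˡ-≤ k length≤ ⟩
      (4ℓ ℕ.* (4ℓ ℕ.* 4ℓ)) ℕ.^ k             ≡⟨ cong (ℕ._^ k) (64ℓ³ ℓ) ⟩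
      (64 ℕ.* (ℓ ℕ.* (ℓ ℕ.* (ℓ ℕ.* 1)))) ℕ.^ k ≡⟨ ^-distribʳ-* k 64 (ℓ ℕ.^ 3) ⟩
      64 ℕ.^ k ℕ.* (ℓ ℕ.^ 3) ℕ.^ k           ≡⟨ cong (64 ℕ.^ k ℕ.*_) (trans (ℕ.^-*-assoc ℓ 3 k)
                                                  (trans (cong (ℓ ℕ.^_) (ℕ.*-comm 3 k)) (sym (ℕ.^-*-assoc ℓ k 3)))) ⟩
      64 ℕ.^ k ℕ.* (ℓ ℕ.^ k) ℕ.^ 3           ≤⟨ ℕ.*-monoʳ-≤ (64 ℕ.^ k) (ℕ.^-monoˡ-≤ 3 few) ⟩
      64 ℕ.^ k ℕ.* (C ℕ.* ∣ N ∣) ℕ.^ 3       ∎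
      where
      open ℕ.≤-Reasoning
      ℓ = length ds
      4ℓ = ℓ ℕ.* 2 ℕ.* 2
      64ℓ³ : ∀ ℓ → ℓ ℕ.* 2 ℕ.* 2 ℕ.* (ℓ ℕ.* 2 ℕ.* 2 ℕ.* (ℓ ℕ.* 2 ℕ.* 2)) ≡ 64 ℕ.* (ℓ ℕ.* (ℓ ℕ.* (ℓ ℕ.* 1)))
      64ℓ³ = ℕSolver.solve-∀

      coordinates : (Triple → ℤ) → List ℤ
      coordinates π = deduplicate ℤ._≟_ (map π xs)
      coordinates-bound : ∀ π → (∀ x → f (π x) ∣ ∏ f x) → length (coordinates π) ≤ 4ℓ
      coordinates-bound π π∣ = subst (λ l → length (coordinates π) ≤ l ℕ.* 2) (length-signed ds)
        (2-1⇒length≤ ℤ._≟_ f f-2-1 (signed ds) (UniqueDec.deduplicate-! ℤ._≟_ (map π xs))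
          (All.deduplicate⁺ ℤ._≟_ (All.map⁺ (All.map (λ {x} e → ∈-signed {ds}
            (covers (ℤ∣.∣⇒∣ᵤ (subst (f (π x) ∣_) e (π∣ x))))) ∏f≡N))))
      ∈-coordinates : ∀ π {x} → x ∈ˡ xs → π x ∈ˡ coordinates π
      ∈-coordinates π x∈ = ∈.∈-deduplicate⁺ ℤ._≟_ (∈.∈-map⁺ π x∈)

      π₁ π₂ π₃ : Triple → ℤ
      π₁ x = proj₁ x
      π₂ x = proj₁ (proj₂ x)
      π₃ x = proj₂ (proj₂ x)
      X₁ = coordinates π₁
      X₂ = coordinates π₂
      X₃ = coordinates π₃

      length≤ : length xs ≤ 4ℓ ℕ.* (4ℓ ℕ.* 4ℓ)
      length≤ = begin
        length xs
          ≤⟨ unique⊆⇒length≤ (Product.≡-dec ℤ._≟_ (Product.≡-dec ℤ._≟_ ℤ._≟_))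
               (cartesianProduct X₁ (cartesianProduct X₂ X₃)) uniq
               (All.tabulate λ x∈ → ∈.∈-cartesianProduct⁺ (∈-coordinates π₁ x∈)
                 (∈.∈-cartesianProduct⁺ (∈-coordinates π₂ x∈) (∈-coordinates π₃ x∈))) ⟩
        length (cartesianProduct X₁ (cartesianProduct X₂ X₃))
          ≡⟨ trans (length-cartesianProductWith _,_ X₁ (cartesianProduct X₂ X₃))
               (cong (length X₁ ℕ.*_) (length-cartesianProductWith _,_ X₂ X₃)) ⟩
        length X₁ ℕ.* (length X₂ ℕ.* length X₃)
          ≤⟨ ℕ.*-mono-≤ (coordinates-bound π₁ λ x → ℤ∣.∣m⇒∣m*n (f (π₃ x)) (ℤ∣.∣m⇒∣m*n (f (π₂ x)) ℤ∣.∣-refl))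
              (ℕ.*-mono-≤ (coordinates-bound π₂ λ x → ℤ∣.∣m⇒∣m*n (f (π₃ x)) (ℤ∣.∣n⇒∣m*n (f (π₁ x)) ℤ∣.∣-refl))
                (coordinates-bound π₃ λ x → ℤ∣.∣n⇒∣m*n (f (π₁ x) * f (π₂ x)) ℤ∣.∣-refl)) ⟩
        4ℓ ℕ.* (4ℓ ℕ.* 4ℓ) ∎

-- Few solutions of the shifted product congruence.

module Solutions
  {p : ℕ} (p-prime : Prime p) (H : ℕ) {{H≢0 : NonZero H}}
  {c} (2976≤c : 2976 ≤ c) (size : c ℕ.* H ℕ.^ 8 ℕ.< p) (Λ : ℤ)
  where
  open import Data.Integer using (_-_)
  open import Data.Integer.Divisibility.Signed using (_∣_)
  open DivisorBound
  open Triples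
  open TripleCounting
  open Integers
  open Bounds H
  open Concentration p-prime H 2976≤c size Λ

  solutions-bound : ∀ k .{{_ : NonZero k}} {C} → (∀ n → .{{NonZero n}} → FewDivisors k C n) →
    ∀ μ → ¬ (+ p ∣ μ) → ∀ {xs} → Unique xs → All (λ x → InBox x × + p ∣ shifted x - μ) xs →
    length xs ℕ.^ k ≤ 64 ℕ.^ k ℕ.* (C ℕ.* (21952 ℕ.* H ℕ.^ 9)) ℕ.^ 3
  solutions-bound (suc k) _ _ _ {[]} _ _ = z≤n
  solutions-bound k {C} few μ p∤μ {xs@(y ∷ _)} uniq sols@((y∈ , y-sol) ∷ _) =
    -- The existence of a small linear polynomial is never decided. The goal is a decidable
    -- inequality, so it suffices to derive it both from such a polynomial and from its absence.
    decidable-stable (_ ℕ.≤? _) λ ¬goal →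
      let none : ¬ SmallLinear
          none s = ¬goal (conclude (smallLinear⇒factoring y y∈ y-unit sols′ s))
      in ¬goal (conclude (¬smallLinear⇒factoring y y∈ y-unit sols′ none))
    where
    y-unit : ¬ (+ p ∣ shifted y)
    y-unit d = p∤μ (subst (+ p ∣_) (identity (shifted y) μ) (ℤ∣.∣m∣n⇒∣m-n d y-sol))
      where
      identity : ∀ i j → i - (i - j) ≡ j
      identity = solve-∀
    sols′ : All (Solution y y∈ y-unit) xs
    sols′ = All.map (λ {x} (x∈ , d) → x∈ , subst (+ p ∣_) (identity (shifted x) (shifted y) μ)
      (ℤ∣.∣m∣n⇒∣m-n d y-sol)) sols
      where
      identity : ∀ i j k → i - k - (j - k) ≡ i - j
      identity = solve-∀
    conclude : Factoring xs → length xs ℕ.^ k ≤ 64 ℕ.^ k ℕ.* (C ℕ.* (21952 ℕ.* H ℕ.^ 9)) ℕ.^ 3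
    conclude (factoring f f-2-1 N N≢0 N-bound ∏f≡N) = ℕ.≤-trans
      (triples-bound f-2-1 {N} {k} {C} (few ℤ.∣ N ∣ {{nonZero N≢0}}) uniq ∏f≡N)
      (ℕ.*-monoʳ-≤ (64 ℕ.^ k) (ℕ.^-monoˡ-≤ 3 (ℕ.*-monoʳ-≤ C (abs≤ N-bound))))

-- Congruences modulo n.

module Congruence (n : ℕ) where
  open import Data.Integer using (_+_; _-_; _*_; -_; _^_; 1ℤ)
  open import Data.Integer.Divisibility.Signed using (_∣_; divides)
  open Defs using (_≈_[mod_])

  infix 4 _≋_
  record _≋_ (i j : ℤ) : Set where
    constructor mod
    field congruent : i ≈ j [mod n ]
  open _≋_ public

  ≋-refl : ∀ {i} → i ≋ i
  ≋-refl {i} = mod (divides (+ 0) (ℤ.i≡j⇒i-j≡0 {i} refl))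

  ≋-sym : ∀ {i j} → i ≋ j → j ≋ i
  ≋-sym {i} {j} (mod d) = mod (subst (+ n ∣_) (identity i j) (ℤ∣.∣m⇒∣-m d))
    where
    identity : ∀ i j → - (i - j) ≡ j - i
    identity = solve-∀

  ≋-trans : ∀ {i j k} → i ≋ j → j ≋ k → i ≋ k
  ≋-trans {i} {j} {k} (mod d) (mod e) = mod (subst (+ n ∣_) (identity i j k) (ℤ∣.∣m∣n⇒∣m+n d e))
    where
    identity : ∀ i j k → i - j + (j - k) ≡ i - k
    identity = solve-∀

  ≋-setoid : Setoid 0ℓ 0ℓ
  ≋-setoid = record
    { _≈_ = _≋_
    ; isEquivalence = record { refl = ≋-refl ; sym = ≋-sym ; trans = ≋-trans }
    }

  module ≋-Reasoning = SetoidReasoning ≋-setoid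

  *-cong : ∀ {i j k l} → i ≋ j → k ≋ l → i * k ≋ j * l
  *-cong {i} {j} {k} {l} (mod d) (mod e) = mod (subst (+ n ∣_) (identity i j k l)
    (ℤ∣.∣m∣n⇒∣m+n (ℤ∣.∣m⇒∣m*n k d) (ℤ∣.∣n⇒∣m*n j e)))
    where
    identity : ∀ i j k l → (i - j) * k + j * (k - l) ≡ i * k - j * l
    identity = solve-∀

  *-congˡ : ∀ {i j} k → i ≋ j → k * i ≋ k * j
  *-congˡ k e = *-cong (≋-refl {k}) e

  *-congʳ : ∀ {i j} k → i ≋ j → i * k ≋ j * k
  *-congʳ k e = *-cong e (≋-refl {k})

  ^-cong : ∀ {i j} → i ≋ j → ∀ m → i ^ m ≋ j ^ m
  ^-cong e zero    = ≋-refl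
  ^-cong e (suc m) = *-cong e (^-cong e m)

  ∣-resp-≋ : ∀ {i j} → i ≋ j → + n ∣ i → + n ∣ j
  ∣-resp-≋ {i} {j} (mod d) e = subst (+ n ∣_) (identity i j) (ℤ∣.∣m∣n⇒∣m-n e d)
    where
    identity : ∀ i j → i - (i - j) ≡ j
    identity = solve-∀

  inverse-power : ∀ u g → u * g ≋ 1ℤ → ∀ m → u ^ m * g ^ m ≋ 1ℤ
  inverse-power u g ug≋1 zero = ≋-refl
  inverse-power u g ug≋1 (suc m) = begin
    u * u ^ m * (g * g ^ m)   ≡⟨ identity u g (u ^ m) (g ^ m) ⟩
    u * g * (u ^ m * g ^ m)   ≈⟨ *-cong ug≋1 (inverse-power u g ug≋1 m) ⟩
    1ℤ                        ∎
    where
    open ≋-Reasoning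
    identity : ∀ u g v h → u * v * (g * h) ≡ u * g * (v * h)
    identity = solve-∀

-- Powers of g modulo p and the removal of negative exponents.

module Progression
  {p g t : ℕ} (p-prime : Prime p) (t-order : Defs.IsMultiplicativeOrder t g p)
  where
  open import Data.Integer using (_+_; _-_; _*_; -_; _^_; 1ℤ; _⊖_)
  open import Data.Integer.Divisibility.Signed using (_∣_)
  open Defs using (ExpCongruence; module IsMultiplicativeOrder)
  open IsMultiplicativeOrder t-order
  open Congruence p
  open Integers

  γ u : ℤ
  γ = + g
  -- As γᵗ is congruent to 1, this power is the inverse of γ modulo p.
  u = γ ^ (t ℕ.∸ 1)

  private
    uγ≋1 : u * γ ≋ 1ℤ
    uγ≋1 = begin
      u * γ                  ≡⟨ ℤ.*-comm u γ ⟩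
      γ ^ (1 ℕ.+ (t ℕ.∸ 1))  ≡⟨ cong (γ ^_) (ℕ.m+[n∸m]≡n positive) ⟩
      γ ^ t                  ≈⟨ mod identity ⟩
      1ℤ                     ∎
      where open ≋-Reasoning

    1-unit : ¬ (+ p ∣ 1ℤ)
    1-unit d = Prime.¬prime[1] (subst Prime (ℕ∣.∣1⇒≡1 (ℤ∣.∣⇒∣ᵤ d)) p-prime)

    unit-factor : ∀ {i j} → i * j ≋ 1ℤ → ¬ (+ p ∣ i)
    unit-factor {i} {j} ij≋1 p∣i = 1-unit (∣-resp-≋ ij≋1 (ℤ∣.∣m⇒∣m*n j p∣i))

    u-unit : ¬ (+ p ∣ u)
    u-unit = unit-factor uγ≋1

  γ-unit : ¬ (+ p ∣ γ)
  γ-unit = unit-factor {γ} {u} (subst (_≋ 1ℤ) (ℤ.*-comm u γ) uγ≋1)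

  *-unit : ∀ {i j} → ¬ (+ p ∣ i) → ¬ (+ p ∣ j) → ¬ (+ p ∣ i * j)
  *-unit {i} {j} p∤i p∤j d = [ p∤i , p∤j ]′ (euclid p-prime i j d)

  ^-unit : ∀ {i} → ¬ (+ p ∣ i) → ∀ n → ¬ (+ p ∣ i ^ n)
  ^-unit p∤i zero = 1-unit
  ^-unit {i} p∤i (suc n) = *-unit {i} p∤i (^-unit p∤i n)

  private
    distinct : ∀ {b i j} → ¬ (+ p ∣ b) → i ℕ.< j → j ℕ.< t → ¬ (b * γ ^ j ≋ b * γ ^ i)
    distinct {b} {i} {j} p∤b i<j j<t (mod d) =
      [ *-unit {b} p∤b (^-unit γ-unit i)
      , (λ e → ℕ.<⇒≱ j<t (ℕ.≤-trans (minimal (ℕ.m<n⇒0<n∸m i<j) e) (ℕ.m∸n≤m j i))) ]′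
      (euclid p-prime (b * γ ^ i) (γ ^ (j ℕ.∸ i) - 1ℤ) (subst (+ p ∣_) (begin
        b * γ ^ j - b * γ ^ i
          ≡⟨ cong (λ n → b * γ ^ n - b * γ ^ i) (sym (ℕ.m+[n∸m]≡n (ℕ.<⇒≤ i<j))) ⟩
        b * γ ^ (i ℕ.+ (j ℕ.∸ i)) - b * γ ^ i
          ≡⟨ cong (λ v → b * v - b * γ ^ i) (ℤ.^-distribˡ-+-* γ i (j ℕ.∸ i)) ⟩
        b * (γ ^ i * γ ^ (j ℕ.∸ i)) - b * γ ^ i
          ≡⟨ factor b (γ ^ i) (γ ^ (j ℕ.∸ i)) ⟩
        b * γ ^ i * (γ ^ (j ℕ.∸ i) - 1ℤ) ∎) d))
      where
      open ≡-Reasoning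
      factor : ∀ b v w → b * (v * w) - b * v ≡ b * v * (w - 1ℤ)
      factor = solve-∀

  exponent-injective : ∀ {b} → ¬ (+ p ∣ b) → ∀ {i j} → i ℕ.< t → j ℕ.< t →
    b * γ ^ i ≋ b * γ ^ j → i ≡ j
  exponent-injective p∤b {i} {j} i<t j<t eq with ℕ.<-cmp i j
  ... | tri≈ _ i≡j _ = i≡j
  ... | tri< i<j _ _ = contradiction (≋-sym eq) (distinct p∤b i<j j<t)
  ... | tri> _ _ j<i = contradiction eq (distinct p∤b j<i i<t)

  -- The factor g^(K+1) is absorbed into b, so that the exponents become 0, ..., M - 1 and no
  -- negative ones remain. For K = -(k + 1) the exponent K + 1 is -k, whence the factor `u ^ k`.
  rebase : ∀ a K → ¬ (+ p ∣ a) → ∃[ b ] ¬ (+ p ∣ b) ×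
    (∀ i {y} → ExpCongruence p g a (K + + suc i) y → y ≋ b * γ ^ i)
  rebase a (+ k) p∤a = a * γ ^ suc k , *-unit {a} p∤a (^-unit γ-unit (suc k)) , λ i {y} e → begin
    y                       ≈⟨ mod e ⟩
    a * γ ^ (k ℕ.+ suc i)   ≡⟨ cong (λ n → a * γ ^ n) (ℕ.+-suc k i) ⟩
    a * γ ^ (suc k ℕ.+ i)   ≡⟨ cong (a *_) (ℤ.^-distribˡ-+-* γ (suc k) i) ⟩
    a * (γ ^ suc k * γ ^ i) ≡⟨ sym (ℤ.*-assoc a (γ ^ suc k) (γ ^ i)) ⟩
    a * γ ^ suc k * γ ^ i   ∎
    where open ≋-Reasoning
  rebase a ℤ.-[1+ k ] p∤a = a * u ^ k , *-unit {a} p∤a (^-unit u-unit k) , shift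
    where
    open ≋-Reasoning
    shift : ∀ i {y} → ExpCongruence p g a (suc i ⊖ suc k) y → y ≋ a * u ^ k * γ ^ i
    shift i {y} e with k ℕ.≤? i
    ... | yes k≤i = begin
      y                                     ≈⟨ mod (subst (λ x → ExpCongruence p g a x y)
                                                 (trans (ℤ.[1+m]⊖[1+n]≡m⊖n i k) (ℤ.⊖-≥ k≤i)) e) ⟩
      a * γ ^ (i ℕ.∸ k)                     ≡⟨ sym (ℤ.*-identityˡ _) ⟩
      1ℤ * (a * γ ^ (i ℕ.∸ k))              ≈⟨ *-congʳ (a * γ ^ (i ℕ.∸ k)) (≋-sym (inverse-power u γ uγ≋1 k)) ⟩
      u ^ k * γ ^ k * (a * γ ^ (i ℕ.∸ k))   ≡⟨ rearrange a (u ^ k) (γ ^ k) (γ ^ (i ℕ.∸ k)) ⟩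
      a * u ^ k * (γ ^ k * γ ^ (i ℕ.∸ k))   ≡⟨ cong (a * u ^ k *_) (sym (ℤ.^-distribˡ-+-* γ k (i ℕ.∸ k))) ⟩
      a * u ^ k * γ ^ (k ℕ.+ (i ℕ.∸ k))     ≡⟨ cong (λ n → a * u ^ k * γ ^ n) (ℕ.m+[n∸m]≡n k≤i) ⟩
      a * u ^ k * γ ^ i                     ∎
      where
      rearrange : ∀ a v h r → v * h * (a * r) ≡ a * v * (h * r)
      rearrange = solve-∀
    ... | no k≰i with k ℕ.∸ i in k∸i≡ | subst (λ x → ExpCongruence p g a x y)
            (trans (ℤ.[1+m]⊖[1+n]≡m⊖n i k) (ℤ.⊖-< (ℕ.≰⇒> k≰i))) e
    ... | zero  | _ = contradiction (ℕ.m∸n≡0⇒m≤n k∸i≡) k≰i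
    ... | suc m | h , γh≈1 , y≈ = begin
      y                                     ≈⟨ mod y≈ ⟩
      a * (+ toℕ h) ^ suc m                 ≈⟨ *-congˡ a (^-cong h≋u (suc m)) ⟩
      a * u ^ suc m                         ≡⟨ sym (ℤ.*-identityʳ _) ⟩
      a * u ^ suc m * 1ℤ                    ≈⟨ *-congˡ (a * u ^ suc m) (≋-sym (inverse-power u γ uγ≋1 i)) ⟩
      a * u ^ suc m * (u ^ i * γ ^ i)       ≡⟨ rearrange a (u ^ suc m) (u ^ i) (γ ^ i) ⟩
      a * (u ^ suc m * u ^ i) * γ ^ i       ≡⟨ cong (λ v → a * v * γ ^ i) (sym (ℤ.^-distribˡ-+-* u (suc m) i)) ⟩
      a * u ^ (suc m ℕ.+ i) * γ ^ i         ≡⟨ cong (λ n → a * u ^ n * γ ^ i)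
                                                 (trans (cong (ℕ._+ i) (sym k∸i≡)) (ℕ.m∸n+n≡m (ℕ.<⇒≤ (ℕ.≰⇒> k≰i)))) ⟩
      a * u ^ k * γ ^ i                     ∎
      where
      rearrange : ∀ a v w h → a * v * (w * h) ≡ a * (v * w) * h
      rearrange = solve-∀
      h≋u : + toℕ h ≋ u
      h≋u = begin
        + toℕ h             ≡⟨ sym (ℤ.*-identityˡ (+ toℕ h)) ⟩
        1ℤ * + toℕ h        ≈⟨ *-congʳ (+ toℕ h) (≋-sym uγ≋1) ⟩
        u * γ * + toℕ h     ≡⟨ ℤ.*-assoc u γ (+ toℕ h) ⟩
        u * (γ * + toℕ h)   ≈⟨ *-congˡ u (mod γh≈1) ⟩
        u * 1ℤ              ≡⟨ ℤ.*-identityʳ u ⟩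
        u                   ∎

-- Points of the box, blocks of the y-range, and triples within a block.

module Points
  {p g t : ℕ} (p-prime : Prime p) (t-order : Defs.IsMultiplicativeOrder t g p)
  (a K L b : ℤ) (M : ℕ) (M<t : M ℕ.< t)
  (b-unit : ¬ (+ p ℤ∣.∣ b))
  (b-rebase : ∀ i {y} → Defs.ExpCongruence p g a (K ℤ.+ + suc i) y →
    Congruence._≋_ p y (b ℤ.* (+ g) ℤ.^ i))
  where
  open import Data.Integer using (_+_; _-_; _*_; -_; ∣_∣; _^_; 1ℤ)
  open import Data.Integer.Divisibility.Signed using (_∣_)
  open Defs using (J; interval; expCongruence?; ExpCongruence)
  open Counting
  open DivisorBound
  open Congruence p
  open Progression p-prime t-order

  Good : ℕ × ℕ → Set
  Good (i , j) = i ℕ.< M × j ℕ.< M × L + + suc j ≋ b * γ ^ i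

  -- The offset j determines gⁱ modulo p, and i < M < t stays below the order of g. Hence a point
  -- may be recovered from its y-coordinate alone.
  offset-injective : ∀ {i j i′ j′} → Good (i , j) → Good (i′ , j′) → j ≡ j′ → i ≡ i′
  offset-injective (i<M , _ , e) (i′<M , _ , e′) refl =
    exponent-injective b-unit (ℕ.<-trans i<M M<t) (ℕ.<-trans i′<M M<t) (≋-trans (≋-sym e) e′)

  private
    solutions : List (ℤ × ℤ)
    solutions = filter (λ (x , y) → expCongruence? p g a x y)
      (cartesianProduct (interval K M) (interval L M))

    index : ℤ × ℤ → ℕ × ℕ
    index (x , y) = ∣ x - (K + 1ℤ) ∣ , ∣ y - (L + 1ℤ) ∣

    index-correct : ∀ i j → index (K + + suc i , L + + suc j) ≡ (i , j)
    index-correct i j = cong₂ _,_ (cong ∣_∣ (identity K (+ i))) (cong ∣_∣ (identity L (+ j)))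
      where
      identity : ∀ k i → k + (1ℤ + i) - (k + 1ℤ) ≡ i
      identity = solve-∀

    Indexed : ℤ × ℤ → Set
    Indexed xy = Good (index xy) × ∃[ i ] ∃[ j ] xy ≡ (K + + suc i , L + + suc j)

    indexed : All Indexed solutions
    indexed = All.tabulate λ { {x , y} xy∈ → go xy∈ }
      where
      go : ∀ {x y} → (x , y) ∈ˡ solutions → Indexed (x , y)
      go xy∈ with ∈.∈-filter⁻ (λ (x , y) → expCongruence? p g a x y)
        {xs = cartesianProduct (interval K M) (interval L M)} xy∈
      ... | xy∈× , e with ∈.∈-cartesianProduct⁻ (interval K M) (interval L M) xy∈×
      ... | x∈ , y∈ with ∈.∈-map⁻ (λ i → K + + suc i) x∈ | ∈.∈-map⁻ (λ j → L + + suc j) y∈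
      ... | i , i∈ , refl | j , j∈ , refl =
        subst Good (sym (index-correct i j)) (∈.∈-upTo⁻ i∈ , ∈.∈-upTo⁻ j∈ , b-rebase i e) , i , j , refl

    index-injective : ∀ {u v} → Indexed u → Indexed v → index u ≡ index v → u ≡ v
    index-injective (_ , i , j , refl) (_ , i′ , j′ , refl) e =
      cong (λ (i , j) → K + + suc i , L + + suc j)
        (trans (sym (index-correct i j)) (trans e (index-correct i′ j′)))

  points : List (ℕ × ℕ)
  points = map index solutions

  length-points : length points ≡ J p g a M K L
  length-points = List.length-map index solutions

  points-good : All Good points
  points-good = All.map⁺ (All.map proj₁ indexed)

  points-unique : Unique points
  points-unique = unique-map index-injective indexed
    (Unique.filter⁺ (λ (x , y) → expCongruence? p g a x y)
      (Unique.cartesianProduct⁺ (interval-unique K) (interval-unique L)))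
    where
    interval-unique : ∀ K → Unique (interval K M)
    interval-unique K = Unique.map⁺ (λ {i} {j} e → ℤ.+-injective (trans (sym (identity K (+ i)))
      (trans (cong (_- (K + 1ℤ)) e) (identity K (+ j))))) (Unique.upTo⁺ M)
      where
      identity : ∀ k i → k + (1ℤ + i) - (k + 1ℤ) ≡ i
      identity = solve-∀

  module _ (H : ℕ) {{H≢0 : NonZero H}} {c} (2976≤c : 2976 ≤ c) (size : c ℕ.* H ℕ.^ 8 ℕ.< p) where
    open Triples
    open Bounds H

    Point³ : Set
    Point³ = (ℕ × ℕ) × (ℕ × ℕ) × (ℕ × ℕ)

    block : ℕ × ℕ → ℕ
    block (_ , j) = j ℕ./ H

    exponent : Point³ → ℕ
    exponent ((i₁ , _) , (i₂ , _) , (i₃ , _)) = i₁ ℕ.+ i₂ ℕ.+ i₃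

    offsets : Point³ → Triple
    offsets ((_ , j₁) , (_ , j₂) , (_ , j₃)) = + (j₁ ℕ.% H) , + (j₂ ℕ.% H) , + (j₃ ℕ.% H)

    module _ (β : ℕ) where

      InBlock : ℕ × ℕ → Set
      InBlock P = Good P × block P ≡ β

      InBlock³ : Point³ → Set
      InBlock³ (P₁ , P₂ , P₃) = InBlock P₁ × InBlock P₂ × InBlock P₃

      -- The point with offset j has y = L + 1 + j, and j = β H + (j mod H) in block β; so y is Λ
      -- plus a remainder in the box.
      Λ : ℤ
      Λ = L + 1ℤ + + (β ℕ.* H)

      open Concentration p-prime H 2976≤c size Λ using (InBox; shifted)
      open Solutions p-prime H 2976≤c size Λ using (solutions-bound)

      j≡ : ∀ {i j} → InBlock (i , j) → j ≡ j ℕ.% H ℕ.+ β ℕ.* H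
      j≡ {j = j} (_ , refl) = DivMod.m≡m%n+[m/n]*n j H

      offsets-injective : ∀ {P Q} → InBlock³ P → InBlock³ Q → offsets P ≡ offsets Q → P ≡ Q
      offsets-injective (b₁ , b₂ , b₃) (b₁′ , b₂′ , b₃′) e = cong₂ _,_
        (point b₁ b₁′ (cong proj₁ e)) (cong₂ _,_
        (point b₂ b₂′ (cong (λ x → proj₁ (proj₂ x)) e))
        (point b₃ b₃′ (cong (λ x → proj₂ (proj₂ x)) e)))
        where
        point : ∀ {i j i′ j′} → InBlock (i , j) → InBlock (i′ , j′) → + (j ℕ.% H) ≡ + (j′ ℕ.% H) →
          (i , j) ≡ (i′ , j′)
        point b b′ e = cong₂ _,_ (offset-injective (proj₁ b) (proj₁ b′) j≡j′) j≡j′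
          where j≡j′ = trans (j≡ b) (trans (cong (ℕ._+ β ℕ.* H) (ℤ.+-injective e)) (sym (j≡ b′)))

      shifted-≋ : ∀ P → InBlock³ P → shifted (offsets P) ≋ b * b * b * γ ^ exponent P
      shifted-≋ ((i₁ , j₁) , (i₂ , j₂) , (i₃ , j₃)) (b₁ , b₂ , b₃) = begin
        (Λ + + (j₁ ℕ.% H)) * (Λ + + (j₂ ℕ.% H)) * (Λ + + (j₃ ℕ.% H))
          ≈⟨ *-cong (*-cong (factor b₁) (factor b₂)) (factor b₃) ⟩
        b * γ ^ i₁ * (b * γ ^ i₂) * (b * γ ^ i₃)
          ≡⟨ rearrange b (γ ^ i₁) (γ ^ i₂) (γ ^ i₃) ⟩
        b * b * b * (γ ^ i₁ * γ ^ i₂ * γ ^ i₃)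
          ≡⟨ cong (b * b * b *_) (trans (cong (_* γ ^ i₃) (sym (ℤ.^-distribˡ-+-* γ i₁ i₂)))
               (sym (ℤ.^-distribˡ-+-* γ (i₁ ℕ.+ i₂) i₃))) ⟩
        b * b * b * γ ^ (i₁ ℕ.+ i₂ ℕ.+ i₃) ∎
        where
        open ≋-Reasoning
        rearrange : ∀ b u v w → b * u * (b * v) * (b * w) ≡ b * b * b * (u * v * w)
        rearrange = solve-∀
        reassociate : ∀ l k r → l + 1ℤ + k + r ≡ l + (1ℤ + (r + k))
        reassociate = solve-∀
        factor : ∀ {i j} → InBlock (i , j) → Λ + + (j ℕ.% H) ≋ b * γ ^ i
        factor {i} {j} b@((_ , _ , e) , _) = subst (_≋ _)
          (trans (cong (λ j → L + + suc j) (j≡ b)) (sym (reassociate L (+ (β ℕ.* H)) (+ (j ℕ.% H))))) e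

      fibre-bound : ∀ k .{{_ : NonZero k}} {C} → (∀ n → .{{NonZero n}} → FewDivisors k C n) →
        ∀ s {Ps} → Unique Ps → All InBlock³ Ps → All (λ P → exponent P ≡ s) Ps →
        length Ps ℕ.^ k ≤ 64 ℕ.^ k ℕ.* (C ℕ.* (21952 ℕ.* H ℕ.^ 9)) ℕ.^ 3
      fibre-bound k {C} few s {Ps} uniq blocks exponents = subst (λ l → l ℕ.^ k ≤ _) (List.length-map offsets Ps)
        (solutions-bound k {C} few (b * b * b * γ ^ s)
          (*-unit {b * b * b} (*-unit {b * b} (*-unit {b} b-unit b-unit) b-unit) (^-unit γ-unit s))
          (unique-map offsets-injective blocks uniq)
          (All.map⁺ (All.map (λ { {P} (blk , refl) → in-box P , congruent (shifted-≋ P blk) })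
            (All.zip (blocks , exponents)))))
        where
        in-box : ∀ P → InBox (offsets P)
        in-box ((_ , j₁) , (_ , j₂) , (_ , j₃)) = small j₁ , small j₂ , small j₃
          where
          small : ∀ j → + (j ℕ.% H) ≲ 1 ^ 1
          small j = bound (ℕ.≤-trans (ℕ.<⇒≤ (DivMod.m%n<n j H))
            (ℕ.≤-reflexive (sym (trans (ℕ.*-identityˡ _) (ℕ.*-identityʳ H)))))

      B : List (ℕ × ℕ)
      B = fibre ℕ._≟_ block β points

      cube : List Point³
      cube = cartesianProduct B (cartesianProduct B B)

      cube-inBlock : All InBlock³ cube
      cube-inBlock = All.tabulate λ P∈ → inBlock P∈
        where
        B-inBlock : All InBlock B
        B-inBlock = All.zip
          ( All.filter⁺ (λ P → block P ℕ.≟ β) points-good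
          , All.all-filter (λ P → block P ℕ.≟ β) points)
        inBlock : ∀ {P} → P ∈ˡ cube → InBlock³ P
        inBlock P∈ with ∈.∈-cartesianProduct⁻ B (cartesianProduct B B) P∈
        ... | P₁∈ , P₂₃∈ with ∈.∈-cartesianProduct⁻ B B P₂₃∈
        ... | P₂∈ , P₃∈ = All.lookup B-inBlock P₁∈ , All.lookup B-inBlock P₂∈ , All.lookup B-inBlock P₃∈

      cube-unique : Unique cube
      cube-unique = Unique.cartesianProduct⁺ B-unique (Unique.cartesianProduct⁺ B-unique B-unique)
        where
        B-unique : Unique B
        B-unique = Unique.filter⁺ (λ P → block P ℕ.≟ β) points-unique

      length-cube : length cube ≡ length B ℕ.* (length B ℕ.* length B)
      length-cube = trans (length-cartesianProductWith _,_ B (cartesianProduct B B))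
        (cong (length B ℕ.*_) (length-cartesianProductWith _,_ B B))

      cube-bound : ∀ k .{{_ : NonZero k}} {C} → (∀ n → .{{NonZero n}} → FewDivisors k C n) →
        ∃[ r ] length B ℕ.* (length B ℕ.* length B) ≤ suc (M ℕ.+ M ℕ.+ M) ℕ.* r ×
          r ℕ.^ k ≤ 64 ℕ.^ k ℕ.* (C ℕ.* (21952 ℕ.* H ℕ.^ 9)) ℕ.^ 3
      cube-bound k {C} few =
        -- The sums of three exponents lie among the 3M + 1 numbers 0, ..., 3M; the key 0 is split
        -- off because the pigeonhole needs a nonempty list of keys.
        let s , _ , cube≤ = pigeonhole ℕ._≟_ exponent 0 (applyUpTo suc (M ℕ.+ M ℕ.+ M)) cube
              (All.map (λ {P} b → exponent∈ {P} b) cube-inBlock)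
            S = fibre ℕ._≟_ exponent s cube
        in length S ,
           subst₂ (λ l m → l ≤ suc m ℕ.* length S)
             length-cube (List.length-applyUpTo suc (M ℕ.+ M ℕ.+ M)) cube≤ ,
           fibre-bound k {C} few s (Unique.filter⁺ (λ P → exponent P ℕ.≟ s) cube-unique)
             (All.filter⁺ (λ P → exponent P ℕ.≟ s) cube-inBlock)
             (All.all-filter (λ P → exponent P ℕ.≟ s) cube)
        where
        exponent∈ : ∀ {P} → InBlock³ P → exponent P ∈ˡ upTo (suc (M ℕ.+ M ℕ.+ M))
        exponent∈ (((i₁< , _) , _) , ((i₂< , _) , _) , ((i₃< , _) , _)) =
          ∈.∈-upTo⁺ (s≤s (ℕ.+-mono-≤ (ℕ.+-mono-≤ (ℕ.<⇒≤ i₁<) (ℕ.<⇒≤ i₂<)) (ℕ.<⇒≤ i₃<)))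

    -- Here ℓ counts the points of a fullest block and r the triples of that block with a most
    -- frequent exponent sum. The three inequalities stay separate because roots are taken only
    -- after H is replaced by M.
    J-bound : ∀ k .{{_ : NonZero k}} {C} → (∀ n → .{{NonZero n}} → FewDivisors k C n) →
      ∃[ ℓ ] ∃[ r ] J p g a M K L ≤ suc (M ℕ./ H) ℕ.* ℓ ×
        ℓ ℕ.* (ℓ ℕ.* ℓ) ≤ suc (M ℕ.+ M ℕ.+ M) ℕ.* r ×
        r ℕ.^ k ≤ 64 ℕ.^ k ℕ.* (C ℕ.* (21952 ℕ.* H ℕ.^ 9)) ℕ.^ 3
    J-bound k {C} few =
      let β , _ , J≤ = pigeonhole ℕ._≟_ block 0 (applyUpTo suc (M ℕ./ H)) points
            (All.map (λ (_ , j<M , _) → ∈.∈-upTo⁺ (s≤s (DivMod./-monoˡ-≤ H (ℕ.<⇒≤ j<M)))) points-good)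
          r , ℓ³≤ , r≤ = cube-bound β k {C} few
      in length (B β) , r ,
         subst₂ (λ l m → l ≤ suc m ℕ.* length (B β))
           length-points (List.length-applyUpTo suc (M ℕ./ H)) J≤ ,
         ℓ³≤ , r≤

-- The choice of the block length and the extraction of roots in ℕ.

module NaturalBound where
  open import Data.Nat using (_+_; _*_; _^_; _/_; _%_; _<_; _⊓_; _≤?_)
  open DivisorBound
  open Defs using (J)

  ^-cancelʳ-≤ : ∀ e .{{_ : NonZero e}} {m n} → m ^ e ≤ n ^ e → m ≤ n
  ^-cancelʳ-≤ e mᵉ≤nᵉ = ℕ.≮⇒≥ λ n<m → ℕ.<⇒≱ (ℕ.^-monoˡ-< e n<m) mᵉ≤nᵉ

  root : ∀ e .{{_ : NonZero e}} n → ∃[ r ] r ^ e ≤ n × n < suc r ^ e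
  root e@(suc _) zero = 0 , z≤n , ℕ.m^n>0 1 e
  root e (suc n) with root e n
  ... | r , rᵉ≤n , n< with suc r ^ e ≤? suc n
  ...   | yes ≤n = suc r , ≤n , ℕ.≤-<-trans n< (ℕ.^-monoˡ-< e ℕ.≤-refl)
  ...   | no ≰n  = r , ℕ.m≤n⇒m≤1+n rᵉ≤n , ℕ.≰⇒> ≰n

  root-positive : ∀ e {r n} → 1 ≤ n → n < suc r ^ e → 1 ≤ r
  root-positive e {zero} 1≤n n<1 = contradiction 1≤n (ℕ.<⇒≱ (subst (_ <_) (ℕ.^-zeroˡ e) n<1))
  root-positive e {suc r} _ _ = s≤s z≤n

  -- Rounding a root r ≥ 1 down loses at most a factor of two, since r + 1 ≤ 2 r.
  root-double : ∀ e {r n} → 1 ≤ n → n < suc r ^ e → n ≤ (2 * r) ^ e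
  root-double e {r} 1≤n n< = ℕ.≤-trans (ℕ.<⇒≤ n<) (ℕ.^-monoˡ-≤ e
    (subst (suc r ≤_) (cong (λ s → r + s) (sym (ℕ.+-identityʳ r))) (ℕ.+-monoˡ-≤ r (root-positive e 1≤n n<))))

  -- Meant for e = 27, f = 3, j = 9: the cube of M⁹ is M²⁷. Passing to `suc c` makes the base
  -- positive, so that its exponent can be raised from f to e even if c = 0.
  take-root : ∀ e f j .{{_ : NonZero e}} → j * f ≡ e → f ≤ e →
    ∀ {a c r M} k → r ^ (e * k) ≤ a ^ (e * k) * (c * M ^ j) ^ f → r ^ k ≤ a ^ k * (suc c * M)
  take-root e f j jf≡e f≤e {a} {c} {r} {M} k r≤ = ^-cancelʳ-≤ e (begin
    (r ^ k) ^ e                              ≡⟨ collect r ⟩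
    r ^ (e * k)                              ≤⟨ r≤ ⟩
    a ^ (e * k) * (c * M ^ j) ^ f            ≡⟨ cong₂ _*_ (sym (collect a)) (^-distribʳ-* f c (M ^ j)) ⟩
    (a ^ k) ^ e * (c ^ f * (M ^ j) ^ f)
      ≤⟨ ℕ.*-monoʳ-≤ ((a ^ k) ^ e) (ℕ.*-mono-≤
           (ℕ.≤-trans (ℕ.^-monoˡ-≤ f (ℕ.n≤1+n c)) (ℕ.^-monoʳ-≤ (suc c) f≤e))
           (ℕ.≤-reflexive (trans (ℕ.^-*-assoc M j f) (cong (M ^_) jf≡e)))) ⟩
    (a ^ k) ^ e * (suc c ^ e * M ^ e)        ≡⟨ cong ((a ^ k) ^ e *_) (sym (^-distribʳ-* e (suc c) M)) ⟩
    (a ^ k) ^ e * (suc c * M) ^ e            ≡⟨ sym (^-distribʳ-* e (a ^ k) (suc c * M)) ⟩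
    (a ^ k * (suc c * M)) ^ e                ∎)
    where
    open ℕ.≤-Reasoning
    collect : ∀ m → (m ^ k) ^ e ≡ m ^ (e * k)
    collect m = trans (ℕ.^-*-assoc m k e) (cong (m ^_) (ℕ.*-comm k e))

  -- H is about p^(1/8) / 3, capped by M.
  module _ {p M} (3⁸≤p : 6561 ≤ p) (1≤M : 1 ≤ M) where

    record Scale : Set where
      field
        H W     : ℕ
        {{H≢0}} : NonZero H
        1≤W     : 1 ≤ W
        H≤M     : H ≤ M
        size    : 6560 * H ^ 8 < p
        p≤W⁸    : p ≤ W ^ 8
        blocks  : suc (M / H) * W ≤ 12 * (M + W)

    scale : Scale
    scale with root 8 p
    ... | A , A⁸≤p , p<W⁸ = record
      { H = H
      ; W = suc A
      ; H≢0 = H≢0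
      ; 1≤W = s≤s z≤n
      ; H≤M = ℕ.m⊓n≤n H₀ M
      ; size = ℕ.≤-<-trans (ℕ.*-monoʳ-≤ 6560 (ℕ.^-monoˡ-≤ 8 (ℕ.m⊓n≤m H₀ M))) size
      ; p≤W⁸ = ℕ.<⇒≤ p<W⁸
      ; blocks = blocks
      }
      where
      open ℕ.≤-Reasoning
      H₀ = A / 3
      H = H₀ ⊓ M
      3≤A : 3 ≤ A
      3≤A = ℕ.≤-pred (ℕ.≰⇒> λ W≤3 → ℕ.<⇒≱ p<W⁸ (ℕ.≤-trans (ℕ.^-monoˡ-≤ 8 W≤3) 3⁸≤p))
      1≤H₀ : 1 ≤ H₀
      1≤H₀ = DivMod./-monoˡ-≤ 3 3≤A
      instance
        H₀≢0 : NonZero H₀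
        H₀≢0 = ℕ.>-nonZero 1≤H₀
        H≢0 : NonZero H
        H≢0 = ℕ.>-nonZero (ℕ.⊓-glb 1≤H₀ 1≤M)
        M≢0 : NonZero M
        M≢0 = ℕ.>-nonZero 1≤M
      -- The constant is 3⁸ - 1: with H₀ at most a third of the root A, 3⁸ H₀⁸ ≤ p, and lowering the
      -- constant by one makes the inequality strict.
      size : 6560 * H₀ ^ 8 < p
      size = begin-strict
        6560 * H₀ ^ 8   <⟨ ℕ.*-monoˡ-< (H₀ ^ 8) {{ℕ.m^n≢0 H₀ 8}} (ℕ.n<1+n 6560) ⟩
        6561 * H₀ ^ 8   ≡⟨ sym (^-distribʳ-* 8 3 H₀) ⟩
        (3 * H₀) ^ 8    ≤⟨ ℕ.^-monoˡ-≤ 8 (subst (_≤ A) (ℕ.*-comm H₀ 3) (DivMod.m/n*n≤m A 3)) ⟩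
        A ^ 8           ≤⟨ A⁸≤p ⟩
        p               ∎
      W≤6H₀ : suc A ≤ H₀ * 6
      W≤6H₀ = begin
        suc A               ≡⟨ cong suc (DivMod.m≡m%n+[m/n]*n A 3) ⟩
        suc (A % 3) + H₀ * 3 ≤⟨ ℕ.+-monoˡ-≤ (H₀ * 3) (DivMod.m%n<n A 3) ⟩
        3 + H₀ * 3          ≤⟨ ℕ.+-monoˡ-≤ (H₀ * 3) (ℕ.*-monoˡ-≤ 3 1≤H₀) ⟩
        H₀ * 3 + H₀ * 3     ≡⟨ sym (ℕ.*-distribˡ-+ H₀ 3 3) ⟩
        H₀ * 6              ∎
      -- If the cap is inactive, W ≤ 6 H₀ turns the number of blocks times W into 6 M; if H = M, the
      -- quotient is 1 and contributes a single W.
      quotient : ∀ h .{{_ : NonZero h}} → h ≡ H₀ ⊎ h ≡ M → (M / h) * suc A ≤ 6 * M + suc A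
      quotient h (inj₁ refl) = begin
        (M / H₀) * suc A      ≤⟨ ℕ.*-monoʳ-≤ (M / H₀) W≤6H₀ ⟩
        (M / H₀) * (H₀ * 6)   ≡⟨ sym (ℕ.*-assoc (M / H₀) H₀ 6) ⟩
        (M / H₀) * H₀ * 6     ≤⟨ ℕ.*-monoˡ-≤ 6 (DivMod.m/n*n≤m M H₀) ⟩
        M * 6                 ≡⟨ ℕ.*-comm M 6 ⟩
        6 * M                 ≤⟨ ℕ.m≤m+n (6 * M) (suc A) ⟩
        6 * M + suc A         ∎
      quotient h (inj₂ refl) = begin
        (M / M) * suc A       ≡⟨ cong (_* suc A) (DivMod.n/n≡1 M) ⟩
        1 * suc A             ≡⟨ ℕ.*-identityˡ (suc A) ⟩
        suc A                 ≤⟨ ℕ.m≤n+m (suc A) (6 * M) ⟩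
        6 * M + suc A         ∎
      blocks : suc (M / H) * suc A ≤ 12 * (M + suc A)
      blocks = begin
        suc A + (M / H) * suc A       ≤⟨ ℕ.+-monoʳ-≤ (suc A) (quotient H (ℕ.⊓-sel H₀ M)) ⟩
        suc A + (6 * M + suc A)       ≤⟨ ℕ.m≤m+n _ (6 * M + 10 * suc A) ⟩
        suc A + (6 * M + suc A) + (6 * M + 10 * suc A) ≡⟨ identity (suc A) M ⟩
        12 * (M + suc A)              ∎
        where
        identity : ∀ w m → w + (6 * m + w) + (6 * m + 10 * w) ≡ 12 * (m + w)
        identity = ℕSolver.solve-∀

  module _ (k : ℕ) .{{_ : NonZero k}} (C : ℕ) where

    private instance
      27k≢0 : NonZero (27 * k)
      27k≢0 = ℕ.m*n≢0 27 k
      3k≢0 : NonZero (3 * k)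
      3k≢0 = ℕ.m*n≢0 3 k

    -- In D, 256 = 4·64 combines 3M + 1 ≤ 4M with the 64 of the triple count.
    C′ D : ℕ
    C′ = suc (C * 21952)
    D = 256 ^ k * C′

    module _ {M ℓ r : ℕ} (1≤M : 1 ≤ M)
      (ℓ³≤ : ℓ * (ℓ * ℓ) ≤ suc (M + M + M) * r)
      (r≤ : r ^ (27 * k) ≤ 64 ^ (27 * k) * (C * (21952 * M ^ 9)) ^ 3)
      where
      open ℕ.≤-Reasoning

      private instance
        M≢0 : NonZero M
        M≢0 = ℕ.>-nonZero 1≤M

      r^k≤ : r ^ k ≤ 64 ^ k * (C′ * M)
      r^k≤ = take-root 27 3 9 refl (ℕ.≤ᵇ⇒≤ 3 27 _) {64} {C * 21952} k
        (subst (λ n → r ^ (27 * k) ≤ 64 ^ (27 * k) * n ^ 3) (sym (ℕ.*-assoc C 21952 (M ^ 9))) r≤)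

      ℓ^3k≤ : ℓ ^ (3 * k) ≤ D * M ^ suc k
      ℓ^3k≤ = begin
        ℓ ^ (3 * k)                           ≡⟨ sym (ℕ.^-*-assoc ℓ 3 k) ⟩
        (ℓ ^ 3) ^ k                           ≡⟨ cong (λ n → (ℓ * (ℓ * n)) ^ k) (ℕ.*-identityʳ ℓ) ⟩
        (ℓ * (ℓ * ℓ)) ^ k                     ≤⟨ ℕ.^-monoˡ-≤ k ℓ³≤ ⟩
        (suc (M + M + M) * r) ^ k             ≤⟨ ℕ.^-monoˡ-≤ k (ℕ.*-monoˡ-≤ r (ℕ.+-monoˡ-≤ (M + M + M) 1≤M)) ⟩
        ((M + (M + M + M)) * r) ^ k           ≡⟨ cong (λ n → (n * r) ^ k) (4M M) ⟩
        (4 * M * r) ^ k                       ≡⟨ trans (^-distribʳ-* k (4 * M) r)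
                                                   (cong (_* r ^ k) (^-distribʳ-* k 4 M)) ⟩
        4 ^ k * M ^ k * r ^ k                 ≤⟨ ℕ.*-monoʳ-≤ (4 ^ k * M ^ k) r^k≤ ⟩
        4 ^ k * M ^ k * (64 ^ k * (C′ * M))   ≡⟨ rearrange (4 ^ k) (M ^ k) (64 ^ k) C′ M ⟩
        4 ^ k * 64 ^ k * C′ * (M * M ^ k)     ≡⟨ cong (λ n → n * C′ * (M * M ^ k)) (sym (^-distribʳ-* k 4 64)) ⟩
        256 ^ k * C′ * (M * M ^ k)            ∎
        where
        4M : ∀ m → m + (m + m + m) ≡ 4 * m
        4M = ℕSolver.solve-∀
        rearrange : ∀ a b c d e → a * b * (c * (d * e)) ≡ a * c * d * (e * b)
        rearrange = ℕSolver.solve-∀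

      -- The exponent k / (3k + 1) falls short of 1/3 by less than 1/(9k), which the factor
      -- M^(1/k) of E makes up for.
      ℓ≤ : ∀ {A E} → M ^ k ≤ (2 * A) ^ suc (3 * k) → M ≤ (2 * E) ^ k → ℓ ≤ D * (2 * A * (2 * E))
      ℓ≤ {A} {E} A-large E-large = ^-cancelʳ-≤ (3 * k * s) {{ℕ.m*n≢0 (3 * k) s}} (begin
        ℓ ^ (3 * k * s)                             ≡⟨ sym (ℕ.^-*-assoc ℓ (3 * k) s) ⟩
        (ℓ ^ (3 * k)) ^ s                           ≤⟨ ℕ.^-monoˡ-≤ s ℓ^3k≤ ⟩
        (D * M ^ suc k) ^ s                         ≡⟨ ^-distribʳ-* s D (M ^ suc k) ⟩
        D ^ s * (M ^ suc k) ^ s                     ≤⟨ ℕ.*-mono-≤ D-bound M-bound ⟩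
        D ^ (3 * k * s) * (2 * A * (2 * E)) ^ (3 * k * s) ≡⟨ sym (^-distribʳ-* (3 * k * s) D (2 * A * (2 * E))) ⟩
        (D * (2 * A * (2 * E))) ^ (3 * k * s)       ∎)
        where
        s = suc (3 * k)
        instance
          D≢0 : NonZero D
          D≢0 = ℕ.m*n≢0 (256 ^ k) C′ {{ℕ.m^n≢0 256 k}}
        D-bound : D ^ s ≤ D ^ (3 * k * s)
        D-bound = ℕ.^-monoʳ-≤ D (ℕ.m≤n*m s (3 * k))
        M-bound : (M ^ suc k) ^ s ≤ (2 * A * (2 * E)) ^ (3 * k * s)
        M-bound = begin
          (M ^ suc k) ^ s                           ≡⟨ ℕ.^-*-assoc M (suc k) s ⟩
          M ^ (suc k * s)                           ≤⟨ ℕ.^-monoʳ-≤ M (ℕ.≤-trans (ℕ.m≤m+n (suc k * s) (5 * k + 2))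
                                                         (ℕ.≤-reflexive (exponents k))) ⟩
          M ^ (k * (3 * k) + 3 * s)                 ≡⟨ ℕ.^-distribˡ-+-* M (k * (3 * k)) (3 * s) ⟩
          M ^ (k * (3 * k)) * M ^ (3 * s)           ≡⟨ cong (_* M ^ (3 * s)) (sym (ℕ.^-*-assoc M k (3 * k))) ⟩
          (M ^ k) ^ (3 * k) * M ^ (3 * s)           ≤⟨ ℕ.*-mono-≤ (ℕ.^-monoˡ-≤ (3 * k) A-large)
                                                         (ℕ.^-monoˡ-≤ (3 * s) E-large) ⟩
          ((2 * A) ^ s) ^ (3 * k) * ((2 * E) ^ k) ^ (3 * s)
            ≡⟨ cong₂ _*_ (trans (ℕ.^-*-assoc (2 * A) s (3 * k)) (cong ((2 * A) ^_) (ℕ.*-comm s (3 * k))))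
                 (trans (ℕ.^-*-assoc (2 * E) k (3 * s)) (cong ((2 * E) ^_) (regroup k s))) ⟩
          (2 * A) ^ (3 * k * s) * (2 * E) ^ (3 * k * s) ≡⟨ sym (^-distribʳ-* (3 * k * s) (2 * A) (2 * E)) ⟩
          (2 * A * (2 * E)) ^ (3 * k * s)           ∎
          where
          exponents : ∀ k → suc k * suc (3 * k) + (5 * k + 2) ≡ k * (3 * k) + 3 * suc (3 * k)
          exponents = ℕSolver.solve-∀
          regroup : ∀ k s → k * (3 * s) ≡ 3 * k * s
          regroup = ℕSolver.solve-∀

  -- W ≈ p^(1/8), A ≈ M^(k/(3k+1)) and E ≈ M^(1/k), up to constant factors.
  record Estimate (k c p M j : ℕ) : Set where
    field
      {W A E} : ℕ
      1≤W     : 1 ≤ W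
      1≤A     : 1 ≤ A
      1≤E     : 1 ≤ E
      p≤W⁸    : p ≤ W ^ 8
      A≤      : A ^ suc (3 * k) ≤ M ^ k
      E≤      : E ^ k ≤ M
      bounded : j * W ≤ c * ((M + W) * (A * E))

  estimate : ∀ k .{{_ : NonZero k}} → ∃[ c ] ∀ {p g t} → Prime p → 6561 ≤ p →
    Defs.IsMultiplicativeOrder t g p → ∀ a K L → ¬ (+ p ℤ∣.∣ a) →
    ∀ {M} → 1 ≤ M → M < t → Estimate k c p M (J p g a M K L)
  -- 48 = 12·2·2: the 12 from the number of blocks, and a 2 for each of the rounded roots A and E.
  estimate k = 48 * D k C , λ {p} {g} {t} p-prime 3⁸≤p t-order a K L p∤a {M} 1≤M M<t →
    let b , b-unit , b-rebase = Progression.rebase p-prime t-order a K p∤a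
        open Scale (scale 3⁸≤p 1≤M)
        ℓ , r , J≤ , ℓ³≤ , r≤ = Points.J-bound p-prime t-order a K L b M M<t b-unit b-rebase
          H {{H≢0}} {6560} (ℕ.≤ᵇ⇒≤ 2976 6560 _) size (27 * k) {{27k≢0}} {C} few
        A , A≤ , A> = root (suc (3 * k)) (M ^ k)
        E , E≤ , E> = root k M
        1≤Mᵏ = ℕ.m^n>0 M {{ℕ.>-nonZero 1≤M}} k
        r≤′ = ℕ.≤-trans r≤ (ℕ.*-monoʳ-≤ (64 ^ (27 * k)) (ℕ.^-monoˡ-≤ 3
                (ℕ.*-monoʳ-≤ C (ℕ.*-monoʳ-≤ 21952 (ℕ.^-monoˡ-≤ 9 H≤M)))))
        ℓ≤DAE = ℓ≤ k C 1≤M ℓ³≤ r≤′ {A} {E} (root-double (suc (3 * k)) 1≤Mᵏ A>) (root-double k 1≤M E>)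
    in record
      { 1≤W = 1≤W
      ; 1≤A = root-positive (suc (3 * k)) 1≤Mᵏ A>
      ; 1≤E = root-positive k 1≤M E>
      ; p≤W⁸ = p≤W⁸
      ; A≤ = A≤
      ; E≤ = E≤
      ; bounded = combine {M = M} {W = W} {n = suc (_/_ M H {{H≢0}})} {A = A} {E = E} {D = D k C} J≤ blocks ℓ≤DAE
      }
    where
    27k≢0 : NonZero (27 * k)
    27k≢0 = ℕ.m*n≢0 27 k
    -- The triple count involves N³, of size H²⁷; divisor exponent 27 k brings its contribution down
    -- to M^(1/k).
    C = proj₁ (few-divisors (27 * k) {{27k≢0}})
    few = proj₂ (few-divisors (27 * k) {{27k≢0}})
    combine : ∀ {j M W n ℓ A E D} → j ≤ n * ℓ → n * W ≤ 12 * (M + W) → ℓ ≤ D * (2 * A * (2 * E)) →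
      j * W ≤ 48 * D * ((M + W) * (A * E))
    combine {j} {M} {W} {n} {ℓ} {A} {E} {D} j≤ nW≤ ℓ≤ = begin
      j * W                                 ≤⟨ ℕ.*-monoˡ-≤ W j≤ ⟩
      n * ℓ * W                             ≡⟨ swap n ℓ W ⟩
      n * W * ℓ                             ≤⟨ ℕ.*-mono-≤ nW≤ ℓ≤ ⟩
      12 * (M + W) * (D * (2 * A * (2 * E))) ≡⟨ regroup (M + W) D A E ⟩
      48 * D * ((M + W) * (A * E))          ∎
      where
      open ℕ.≤-Reasoning
      swap : ∀ a b c → a * b * c ≡ a * c * b
      swap = ℕSolver.solve-∀
      regroup : ∀ s d a e → 12 * s * (d * (2 * a * (2 * e))) ≡ 48 * d * (s * (a * e))
      regroup = ℕSolver.solve-∀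

-- Natural numbers inside ℚ, powers, and the rational exponents.

module Rationals where
  open import Data.Rational using (_+_; _*_; _<_)
  open ℚ^ using (_^_)

  ℚ-ring : AlmostCommutativeRing 0ℓ 0ℓ
  ℚ-ring = fromCommutativeRing ℚ.+-*-commutativeRing (λ _ → nothing)

  ι : ℕ → ℚ
  ι n = + n ℚ./ 1

  private
    ι≡ : ∀ n → ι n ≡ mkℚ (+ n) 0 (Coprime.sym (Coprime.1-coprimeTo n))
    ι≡ n = ℚ.↥p/↧p≡p (mkℚ (+ n) 0 (Coprime.sym (Coprime.1-coprimeTo n)))

  ι-+ : ∀ m n → ι (m ℕ.+ n) ≡ ι m + ι n
  ι-+ m n = trans (cong (ℚ._/ 1) (cong₂ ℤ._+_ (sym (ℤ.*-identityʳ (+ m))) (sym (ℤ.*-identityʳ (+ n)))))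
    (sym (cong₂ _+_ (ι≡ m) (ι≡ n)))

  ι-* : ∀ m n → ι (m ℕ.* n) ≡ ι m * ι n
  ι-* m n = trans (cong (ℚ._/ 1) (ℤ.pos-* m n)) (sym (cong₂ _*_ (ι≡ m) (ι≡ n)))

  ι-mono-≤ : ∀ {m n} → m ≤ n → ι m ℚ.≤ ι n
  ι-mono-≤ {m} {n} m≤n = subst₂ ℚ._≤_ (sym (ι≡ m)) (sym (ι≡ n))
    (*≤* (ℤ.*-monoʳ-≤-nonNeg (+ 1) (ℤ.+≤+ m≤n)))

  ι-mono-< : ∀ {m n} → m ℕ.< n → ι m < ι n
  ι-mono-< {m} {n} m<n = subst₂ _<_ (sym (ι≡ m)) (sym (ι≡ n))
    (*<* (ℤ.*-monoʳ-<-pos (+ 1) (ℤ.+<+ m<n)))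

  ι-^ : ∀ m n → ι (m ℕ.^ n) ≡ ι m ^ n
  ι-^ m zero    = refl
  ι-^ m (suc n) = trans (ι-* m (m ℕ.^ n)) (cong (ι m *_) (ι-^ m n))

  ι-pos : ∀ {n} → 1 ≤ n → 0ℚ < ι n
  ι-pos = ι-mono-<

  *-pos : ∀ {x y} → 0ℚ < x → 0ℚ < y → 0ℚ < x * y
  *-pos {x} {y} 0<x 0<y = subst (_< x * y) (ℚ.*-zeroʳ x) (ℚ.*-monoʳ-<-pos x {{ℚ.positive 0<x}} 0<y)

  *-mono-≤ : ∀ {x y z w} → 0ℚ ℚ.≤ x → 0ℚ ℚ.≤ w → x ℚ.≤ y → z ℚ.≤ w → x * z ℚ.≤ y * w
  *-mono-≤ {x} {w = w} 0≤x 0≤w x≤y z≤w = ℚ.≤-trans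
    (ℚ.*-monoˡ-≤-nonNeg x {{ℚ.nonNegative 0≤x}} z≤w)
    (ℚ.*-monoʳ-≤-nonNeg w {{ℚ.nonNegative 0≤w}} x≤y)

  half-< : ∀ {x} → 0ℚ < x → x * ½ < x
  half-< {x} 0<x = subst (x * ½ <_) (ℚ.*-identityʳ x)
    (ℚ.*-monoʳ-<-pos x {{ℚ.positive 0<x}} {½} {1ℚ} (*<* (ℤ.+<+ (s≤s (s≤s z≤n)))))

  half-pos : ∀ {x} → 0ℚ < x → 0ℚ < x * ½
  half-pos 0<x = *-pos 0<x (*<* (ℤ.+<+ (s≤s z≤n)))

  ^-pos : ∀ {x} → 0ℚ < x → ∀ n → 0ℚ < x ^ n
  ^-pos 0<x zero    = *<* (ℤ.+<+ (s≤s z≤n))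
  ^-pos 0<x (suc n) = *-pos 0<x (^-pos 0<x n)

  ^-mono-≤ : ∀ {x y} → 0ℚ < x → x ℚ.≤ y → ∀ n → x ^ n ℚ.≤ y ^ n
  ^-mono-≤ 0<x x≤y zero    = ℚ.≤-refl
  ^-mono-≤ 0<x x≤y (suc n) = *-mono-≤ (ℚ.<⇒≤ 0<x) (ℚ.<⇒≤ (^-pos (ℚ.<-≤-trans 0<x x≤y) n))
    x≤y (^-mono-≤ 0<x x≤y n)

  ^-cancel-≤ : ∀ {x y} → 0ℚ < y → ∀ n → x ^ suc n ℚ.≤ y ^ suc n → x ℚ.≤ y
  ^-cancel-≤ {x} {y} 0<y n xⁿ≤yⁿ = ℚ.≮⇒≥ λ y<x → ℚ.<-irrefl refl (ℚ.<-≤-trans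
    (ℚ.<-≤-trans (ℚ.*-monoˡ-<-pos (y ^ n) {{ℚ.positive (^-pos 0<y n)}} y<x)
      (ℚ.*-monoˡ-≤-nonNeg x {{ℚ.nonNegative (ℚ.<⇒≤ (ℚ.<-trans 0<y y<x))}} (^-mono-≤ 0<y (ℚ.<⇒≤ y<x) n)))
    xⁿ≤yⁿ)

  reciprocal : ∀ {x} → 0ℚ < x → ∃[ y ] 0ℚ < y × x * y ≡ 1ℚ
  reciprocal {x} 0<x = (ℚ.1/ x) , ℚ.positive⁻¹ (ℚ.1/ x) {{ℚ.1/pos⇒pos x}} , ℚ.*-inverseʳ x
    where
    instance
      x-pos = ℚ.positive 0<x
      x-nz  = ℚ.pos⇒nonZero x

  unit-fraction : ℕ → ℚ
  unit-fraction k = mkℚ (+ 1) k (Coprime.1-coprimeTo (suc k))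

  -- If q = n / d with n ≥ 1, then 1 / (d + 1) < 1 / d ≤ q; `mkℚ` stores the denominator less one.
  unit-fraction-< : ∀ {q} → 0ℚ < q → unit-fraction (↧ₙ q) < q
  unit-fraction-< {mkℚ (+ zero) _ _} (*<* (ℤ.+<+ ()))
  unit-fraction-< {mkℚ (+ suc n) d _} _ = *<* (ℤ.+<+ (ℕ.≤-trans
    (s≤s (ℕ.≤-reflexive (ℕ.+-identityʳ (suc d)))) (ℕ.m≤m+n (suc (suc d)) (n ℕ.* suc (suc d)))))
  unit-fraction-< {mkℚ ℤ.-[1+ _ ] _ _} (*<* ())

  -- The real power M^(1/3) is a supremum over exponents strictly below 1/3, so a witness needs such
  -- an exponent; k / (3k + 1) is one in lowest terms that tends to 1/3.
  below-⅓ : ℕ → ℚ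
  below-⅓ k = mkℚ (+ k) (3 ℕ.* k) λ {d} (d∣k , d∣1+3k) → ℕ∣.∣1⇒≡1
    (ℕ∣.∣m+n∣m⇒∣n (subst (d ℕ∣.∣_) (ℕ.+-comm 1 (3 ℕ.* k)) d∣1+3k) (ℕ∣.∣n⇒∣m*n 3 d∣k))

  below-⅓-< : ∀ k → below-⅓ k < + 1 ℚ./ 3
  below-⅓-< k = *<* (subst₂ ℤ._<_ (ℤ.pos-* k 3) (sym (ℤ.*-identityˡ (+ suc (3 ℕ.* k))))
    (ℤ.+<+ (s≤s (ℕ.≤-reflexive (ℕ.*-comm k 3)))))

-- Membership in the lower cuts of the theorem.

module Reals where
  open import Data.Rational using (_+_; _*_; _<_)
  open Rationals
  open ℚ^ using (_^_; ^-assocʳ)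
  open Defs using (ℝ⁺; _∈_; fromℕ; fromℚ; _⁻¹)

  ∈-fromℕ : ∀ n .{{_ : NonZero n}} {q} → q < ι n → q ∈ fromℕ n
  ∈-fromℕ (suc n) q<n = q<n

  -- A member of the cut lies strictly below some q′ with q′ at most a rational power; q′ is m
  -- itself, and halving m gives strictness.
  ∈-^ : ∀ n .{{_ : NonZero n}} ε r → 0ℚ < r → r ∈ ε → ∀ {m} → 1 ≤ m →
    m ℕ.^ ↧ₙ r ≤ n ℕ.^ ℤ.∣ ↥ r ∣ → ι m * ½ ∈ n Defs.^ ε
  ∈-^ n ε r 0<r r∈ε {m} 1≤m mᵇ≤nᵃ = ι m , half-< (ι-pos 1≤m) , r , 0<r , r∈ε , ι-pos 1≤m ,
    subst₂ ℚ._≤_ (ι-^ m (↧ₙ r)) (ι-^ n ℤ.∣ ↥ r ∣) (ι-mono-≤ mᵇ≤nᵃ)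

  -- For an exponent a / b < 1/8 one has pᵃ ≤ W^(8a) ≤ Wᵇ, so all members of the cut of p^(1/8) are
  -- at most W, and w = 1 / W is below the inverse.
  ∈-p^⅛⁻¹ : ∀ p .{{_ : NonZero p}} {W w} → p ≤ W ℕ.^ 8 → 1 ≤ W → 0ℚ < w → ι W * w ≡ 1ℚ →
    w * ½ ∈ (p Defs.^ fromℚ (+ 1 ℚ./ 8)) ⁻¹
  ∈-p^⅛⁻¹ p {W} {w} p≤W⁸ 1≤W 0<w Ww≡1 = w , half-< 0<w ,
    λ { {q} _ (q′ , q<q′ , r , 0<r , r<⅛ , 0<q′ , q′ᵇ≤pᵃ) →
      subst (q * w ℚ.≤_) Ww≡1 (ℚ.*-monoʳ-≤-nonNeg w {{ℚ.nonNegative (ℚ.<⇒≤ 0<w)}}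
        (ℚ.≤-trans (ℚ.<⇒≤ q<q′) (≤W r 0<r r<⅛ q′ᵇ≤pᵃ))) }
    where
    numerator : ∀ r → 0ℚ < r → r < + 1 ℚ./ 8 → 8 ℕ.* ℤ.∣ ↥ r ∣ ≤ ↧ₙ r
    numerator (mkℚ (+ a) d _) _ (*<* 8a<b) = ℕ.<⇒≤ (subst (ℕ._< suc d) (ℕ.*-comm a 8)
      (ℤ.drop‿+<+ (subst₂ ℤ._<_ (sym (ℤ.pos-* a 8)) (ℤ.*-identityˡ (+ suc d)) 8a<b)))
    numerator (mkℚ ℤ.-[1+ _ ] _ _) (*<* ()) _
    ≤W : ∀ r → 0ℚ < r → r < + 1 ℚ./ 8 → ∀ {q} → q ^ ↧ₙ r ℚ.≤ ι p ^ ℤ.∣ ↥ r ∣ → q ℚ.≤ ι W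
    ≤W r 0<r r<⅛ qᵇ≤ = ^-cancel-≤ (ι-pos 1≤W) (ℚ.denominator-1 r) (ℚ.≤-trans qᵇ≤
      (subst₂ ℚ._≤_ (ι-^ p ℤ.∣ ↥ r ∣) (ι-^ W (↧ₙ r)) (ι-mono-≤ (begin
        p ℕ.^ ℤ.∣ ↥ r ∣                ≤⟨ ℕ.^-monoˡ-≤ ℤ.∣ ↥ r ∣ p≤W⁸ ⟩
        (W ℕ.^ 8) ℕ.^ ℤ.∣ ↥ r ∣        ≡⟨ ℕ.^-*-assoc W 8 ℤ.∣ ↥ r ∣ ⟩
        W ℕ.^ (8 ℕ.* ℤ.∣ ↥ r ∣)        ≤⟨ ℕ.^-monoʳ-≤ W {{ℕ.>-nonZero 1≤W}} (numerator r 0<r r<⅛) ⟩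
        W ℕ.^ ↧ₙ r                     ∎))))
      where open ℕ.≤-Reasoning

  open NaturalBound using (Estimate)

  -- The witnesses for the sum and the products are halved nine times in all, and 512 = 2⁹ restores
  -- the loss. Multiplication by W then removes w and leaves the integer estimate.
  estimate⇒< : ∀ {k d p M j} .{{_ : NonZero p}} .{{_ : NonZero M}} → 1 ≤ M → ∀ ε →
    unit-fraction k ∈ ε → Estimate (suc k) d p M j →
    j Defs.< (fromℕ 1 Defs.+ fromℕ M Defs.* (p Defs.^ fromℚ (+ 1 ℚ./ 8)) ⁻¹)
      Defs.* (M Defs.^ fromℚ (+ 1 ℚ./ 3) Defs.* (fromℕ (512 ℕ.* suc d) Defs.* M Defs.^ ε))
  estimate⇒< {k} {d} {p} {M} {j} 1≤M ε k∈ε est =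
    let w , 0<w , Ww≡1 = reciprocal (ι-pos 1≤W)
        c = 512 ℕ.* suc d
        0<c = ι-pos {c} (s≤s z≤n)
        m = ι M * ½
        v = w * ½
        0<mv = *-pos (half-pos (ι-pos 1≤M)) (half-pos 0<w)
        -- Any rational below 1 would represent the summand 1; this one carries three halvings, as
        -- `m * v * ½` does, so that the power of ½ factors out of the sum.
        ⅛ = ½ * ½ * ½
        x = (⅛ + m * v * ½) * ½
        0<⅛+ = ℚ.+-mono-< {0ℚ} {⅛} {0ℚ} (*<* (ℤ.+<+ (s≤s z≤n))) (half-pos 0<mv)
        f = ι A * ½
        h = ι c * ½ * (ι E * ½)
        0<h = *-pos (half-pos 0<c) (half-pos (ι-pos 1≤E))
        0<fh = *-pos (half-pos (ι-pos 1≤A)) (half-pos 0<h)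
        y = f * (h * ½) * ½
        x∈ = ⅛ , m * v * ½ , ∈-fromℕ 1 {⅛} (*<* (ℤ.+<+ (s≤s (s≤s z≤n)))) ,
          (m , v , half-pos (ι-pos 1≤M) , half-pos 0<w , ∈-fromℕ M (half-< (ι-pos 1≤M)) ,
            ∈-p^⅛⁻¹ p p≤W⁸ 1≤W 0<w Ww≡1 , half-< 0<mv) ,
          half-< 0<⅛+
        y∈ = f , h * ½ , half-pos (ι-pos 1≤A) , half-pos 0<h ,
          ∈-^ M (fromℚ (+ 1 ℚ./ 3)) (below-⅓ (suc k)) (*<* (ℤ.+<+ (s≤s z≤n))) (below-⅓-< (suc k)) 1≤A A≤ ,
          (ι c * ½ , ι E * ½ , half-pos 0<c , half-pos (ι-pos 1≤E) , ∈-fromℕ c (half-< 0<c) ,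
            ∈-^ M ε (unit-fraction k) (*<* (ℤ.+<+ (s≤s z≤n))) k∈ε 1≤E
              (ℕ.≤-trans E≤ (ℕ.≤-reflexive (sym (ℕ.*-identityʳ M)))) ,
            half-< 0<h) ,
          half-< 0<fh
    in x , y , half-pos 0<⅛+ , half-pos 0<fh , x∈ , y∈ ,
       product-bound w 0<w Ww≡1
    where
    open Estimate est
    product-bound : ∀ w → 0ℚ < w → ι W * w ≡ 1ℚ →
      ι j < (½ * ½ * ½ + ι M * ½ * (w * ½) * ½) * ½ *
        (ι A * ½ * (ι (512 ℕ.* suc d) * ½ * (ι E * ½) * ½) * ½)
    product-bound w 0<w Ww≡1 = ℚ.*-cancelˡ-<-nonNeg (ι W) {{ℚ.nonNegative (ℚ.<⇒≤ (ι-pos 1≤W))}} (subst₂ _<_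
      (trans (ι-* j W) (ℚ.*-comm (ι j) (ι W))) (sym right) (ι-mono-< strict))
      where
      strict : j ℕ.* W ℕ.< suc d ℕ.* ((M ℕ.+ W) ℕ.* (A ℕ.* E))
      -- The real inequality is strict, which is why the constant is `suc d` and not d.
      strict = ℕ.≤-<-trans bounded (ℕ.*-monoˡ-< ((M ℕ.+ W) ℕ.* (A ℕ.* E))
        {{ℕ.>-nonZero (ℕ.*-mono-≤ {1} {_} {1} (ℕ.≤-trans 1≤M (ℕ.m≤m+n M W)) (ℕ.*-mono-≤ {1} {_} {1} 1≤A 1≤E))}}
        (ℕ.n<1+n d))
      identity : ∀ h W w M A E c → W * ((h * h * h + M * h * (w * h) * h) * h * (A * h * (c * h * (E * h) * h) * h))
        ≡ (W + M * (W * w)) * (A * E) * (c * (h * h * h * h * h * h * h * h * h))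
      identity = RingSolver.solve-∀ ℚ-ring
      right : ι W * ((½ * ½ * ½ + ι M * ½ * (w * ½) * ½) * ½ *
        (ι A * ½ * (ι (512 ℕ.* suc d) * ½ * (ι E * ½) * ½) * ½)) ≡ ι (suc d ℕ.* ((M ℕ.+ W) ℕ.* (A ℕ.* E)))
      right = begin
        _ ≡⟨ identity ½ (ι W) w (ι M) (ι A) (ι E) (ι (512 ℕ.* suc d)) ⟩
        (ι W + ι M * (ι W * w)) * (ι A * ι E) * (ι (512 ℕ.* suc d) * h⁹)
          ≡⟨ cong₂ (λ a b → (ι W + ι M * a) * (ι A * ι E) * (b * h⁹)) Ww≡1 (ι-* 512 (suc d)) ⟩
        (ι W + ι M * 1ℚ) * (ι A * ι E) * (ι 512 * ι (suc d) * h⁹)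
          ≡⟨ regroup (ι W) (ι M) (ι A * ι E) (ι 512) (ι (suc d)) h⁹ 1ℚ ⟩
        ι (suc d) * ((ι M * 1ℚ + ι W) * (ι A * ι E)) * (ι 512 * h⁹)
          ≡⟨ cong (λ a → ι (suc d) * ((a + ι W) * (ι A * ι E)) * 1ℚ) (ℚ.*-identityʳ (ι M)) ⟩
        ι (suc d) * ((ι M + ι W) * (ι A * ι E)) * 1ℚ
          ≡⟨ ℚ.*-identityʳ _ ⟩
        ι (suc d) * ((ι M + ι W) * (ι A * ι E))
          ≡⟨ cong (ι (suc d) *_) (cong₂ _*_ (sym (ι-+ M W)) (sym (ι-* A E))) ⟩
        ι (suc d) * (ι (M ℕ.+ W) * ι (A ℕ.* E))
          ≡⟨ cong (ι (suc d) *_) (sym (ι-* (M ℕ.+ W) (A ℕ.* E))) ⟩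
        ι (suc d) * ι ((M ℕ.+ W) ℕ.* (A ℕ.* E))
          ≡⟨ sym (ι-* (suc d) ((M ℕ.+ W) ℕ.* (A ℕ.* E))) ⟩
        ι (suc d ℕ.* ((M ℕ.+ W) ℕ.* (A ℕ.* E))) ∎
        where
        open ≡-Reasoning
        h⁹ : ℚ
        h⁹ = ½ * ½ * ½ * ½ * ½ * ½ * ½ * ½ * ½
        regroup : ∀ W M b c d h o → (W + M * o) * b * (c * d * h) ≡ d * ((M * o + W) * b) * (c * h)
        regroup = RingSolver.solve-∀ ℚ-ring

open import Defs
open import Data.Integer.Divisibility.Signed using (_∣_)
open import Data.Rational using (_/_)

corollary4 : ∃[ p₀ ] ((ε : ℝ⁺) → ∃[ c ]
    ((p : ℕ) (p-prime : Prime p) → p₀ ≤ p →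
    (g : ℕ) → 2 ≤ g →
    (t : ℕ) → IsMultiplicativeOrder t g p →
    (a K L : ℤ) → ¬ (+ p ∣ a) →
    (M : ℕ) (1≤M : 1 ≤ M) → M ℕ.< t →
    let instance
          p-nonZero = prime⇒nonZero p-prime
          M-nonZero = >-nonZero 1≤M
    in J p g a M K L <
        (fromℕ 1 + fromℕ M * (p ^ fromℚ (+ 1 / 8)) ⁻¹)
          * (M ^ fromℚ (+ 1 / 3) * (c * M ^ ε))))
-- 6561 = 3⁸ makes the integer part of p^(1/8) at least 3, so that a third of it is still a positive
-- block length.
corollary4 = 6561 , λ ε →
  -- A positive rational q in the cut ε has 1 / (k + 1) below it, k being its denominator; the
  -- natural-number estimate is used with k + 1.
  let q , 0<q , q∈ε = ℝ⁺.open′ ε (ℝ⁺.zero∈ ε)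
      k = ↧ₙ q
      d , bound = NaturalBound.estimate (suc k)
  in fromℕ (512 ℕ.* suc d) , λ p p-prime p₀≤p g _ t t-order a K L p∤a M 1≤M M<t →
    Reals.estimate⇒< {{prime⇒nonZero p-prime}} {{>-nonZero 1≤M}} 1≤M ε
      (ℝ⁺.down ε (Rationals.unit-fraction-< 0<q) q∈ε)
      (bound p-prime p₀≤p t-order a K L p∤a 1≤M M<t)
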